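{- Let $K_n$ be the complete graph on $n$ vertices. Then the cartesian product $K_n\times K_2$ satisfies $$E_R(K_n\times K_2)=\frac{10n^2+4n-8}{n(n+2)}.$$
   Context: For a connected graph $G$ with vertices $v_1,\dots,v_m$, Laplacian matrix $L$ (degree matrix minus adjacency matrix) and Moore-Penrose inverse $L^\dagger=(l^\dagger_{ij})$, the resistance distance is $r_{ij}=l^\dagger_{ii}+l^\dagger_{jj}-2l^\dagger_{ij}$, and the resistance distance matrix is $R(G)=(r_{ij})_{m\times m}$. The resistance energy $E_R(G)$ is the sum of the absolute values of the eigenvalues of $R(G)$, counted with multiplicity. The cartesian product $G_1\times G_2$ has vertex set $V(G_1)\times V(G_2)$, with $(v_1,u_1)$ and $(v_2,u_2)$ adjacent if $v_1=v_2$ and $u_1u_2\in E(G_2)$, or $u_1=u_2$ and $v_1v_2\in E(G_1)$. -}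

module Defs where

open import Algebra.Bundles using (CommutativeRing)
open import Data.Bool.Base using (if_then_else_)
open import Data.Fin.Base as Fin using (Fin; zero; suc; toℕ; punchIn; remQuot)
import Data.Fin.Properties as Fin
import Data.Integer.Base as ℤ
open import Data.List.Base using (length; filter; allFin)
open import Data.Nat.Base as ℕ using (ℕ; zero; suc; _≤_)
import Data.Nat.Properties as ℕ
open import Data.Product.Base using (_×_; _,_; ∃)
open import Data.Rational.Base as ℚ using (ℚ; 0ℚ; 1ℚ; ½)
import Data.Rational.Properties as ℚ
open import Data.Rational.Solver using (module +-*-Solver)
open import Data.Sum.Base using (_⊎_; inj₁; inj₂)
open import Data.Vec.Functional using (Vector)
open import Function.Base using (case_of_)
open import Level using (0ℓ; _⊔_)
open import Relation.Binary.Construct.Closure.ReflexiveTransitive using (Star)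
open import Relation.Binary.Core using (Rel)
open import Relation.Binary.Definitions using (Decidable; Irreflexive; Symmetric)
open import Relation.Binary.PropositionalEquality
  using (_≡_; _≢_; refl; sym; trans; cong; subst; ≢-sym)
open import Relation.Binary.Structures using (IsEquivalence)
open import Relation.Nullary.Decidable.Core using (does; ¬?; _×-dec_; _⊎-dec_)

-- Real numbers are Cauchy sequences of rationals, equal when their difference
-- tends to 0.

Eventually : (ℕ → Set) → Set
Eventually P = ∃ λ N → ∀ n → N ≤ n → P n

IsCauchy : (ℕ → ℚ) → Set
IsCauchy x = ∀ ε → 0ℚ ℚ.< ε →
  ∃ λ N → ∀ m n → N ≤ m → N ≤ n → ℚ.∣ x m ℚ.- x n ∣ ℚ.< ε

record ℝ : Set where
  constructor mkℝ
  field
    seq    : ℕ → ℚ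
    cauchy : IsCauchy seq

open ℝ public

infix 4 _≈ᴿ_
_≈ᴿ_ : Rel ℝ 0ℓ
x ≈ᴿ y = ∀ ε → 0ℚ ℚ.< ε → Eventually (λ n → ℚ.∣ seq x n ℚ.- seq y n ∣ ℚ.< ε)

private
  open +-*-Solver using (solve; _:+_; _:*_; :-_; _:-_; _:=_)

  half-pos : ∀ {ε} → 0ℚ ℚ.< ε → 0ℚ ℚ.< ½ ℚ.* ε
  half-pos {ε} 0<ε = subst (ℚ._< ½ ℚ.* ε) (ℚ.*-zeroʳ ½) (ℚ.*-monoʳ-<-pos ½ 0<ε)

  half+half : ∀ ε → ½ ℚ.* ε ℚ.+ ½ ℚ.* ε ≡ ε
  half+half ε = trans (sym (ℚ.*-distribʳ-+ ε ½ ½)) (ℚ.*-identityˡ ε)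

  abs-split : ∀ {a} b c {ε} → a ≡ b ℚ.+ c →
              ℚ.∣ b ∣ ℚ.< ½ ℚ.* ε → ℚ.∣ c ∣ ℚ.< ½ ℚ.* ε → ℚ.∣ a ∣ ℚ.< ε
  abs-split {a} b c {ε} refl p q = ℚ.≤-<-trans (ℚ.∣p+q∣≤∣p∣+∣q∣ b c)
    (subst (ℚ.∣ b ∣ ℚ.+ ℚ.∣ c ∣ ℚ.<_) (half+half ε) (ℚ.+-mono-< p q))

  -‿comm-abs : ∀ a b → ℚ.∣ a ℚ.- b ∣ ≡ ℚ.∣ b ℚ.- a ∣
  -‿comm-abs a b = trans (sym (ℚ.∣-p∣≡∣p∣ (a ℚ.- b)))
    (cong ℚ.∣_∣ (solve 2 (λ a b → :- (a :- b) := b :- a) refl a b))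

  abs-≤ : ∀ a b → ℚ.∣ a ∣ ℚ.- ℚ.∣ b ∣ ℚ.≤ ℚ.∣ a ℚ.- b ∣
  abs-≤ a b = begin
    ℚ.∣ a ∣ ℚ.- ℚ.∣ b ∣
      ≡⟨ cong (λ z → ℚ.∣ z ∣ ℚ.- ℚ.∣ b ∣)
           (solve 2 (λ a b → a := (a :- b) :+ b) refl a b) ⟩
    ℚ.∣ (a ℚ.- b) ℚ.+ b ∣ ℚ.- ℚ.∣ b ∣
      ≤⟨ ℚ.+-monoˡ-≤ (ℚ.- ℚ.∣ b ∣) (ℚ.∣p+q∣≤∣p∣+∣q∣ (a ℚ.- b) b) ⟩
    (ℚ.∣ a ℚ.- b ∣ ℚ.+ ℚ.∣ b ∣) ℚ.- ℚ.∣ b ∣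
      ≡⟨ solve 2 (λ u v → (u :+ v) :- v := u) refl ℚ.∣ a ℚ.- b ∣ ℚ.∣ b ∣ ⟩
    ℚ.∣ a ℚ.- b ∣ ∎
    where open ℚ.≤-Reasoning

  abs-lipschitz : ∀ a b → ℚ.∣ ℚ.∣ a ∣ ℚ.- ℚ.∣ b ∣ ∣ ℚ.≤ ℚ.∣ a ℚ.- b ∣
  abs-lipschitz a b with ℚ.∣p∣≡p∨∣p∣≡-p (ℚ.∣ a ∣ ℚ.- ℚ.∣ b ∣)
  ... | inj₁ eq = subst (ℚ._≤ ℚ.∣ a ℚ.- b ∣) (sym eq) (abs-≤ a b)
  ... | inj₂ eq = subst (ℚ._≤ ℚ.∣ a ℚ.- b ∣)
    (sym (trans eq (solve 2 (λ u v → :- (u :- v) := v :- u) refl ℚ.∣ a ∣ ℚ.∣ b ∣)))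
    (subst (ℚ.∣ b ∣ ℚ.- ℚ.∣ a ∣ ℚ.≤_) (-‿comm-abs b a) (abs-≤ b a))

  scale : ∀ ε B → 0ℚ ℚ.< ε → 0ℚ ℚ.< B → ∃ λ δ → 0ℚ ℚ.< δ × δ ℚ.* B ≡ ½ ℚ.* ε
  scale ε B 0<ε 0<B = ½ ℚ.* ε ℚ.* B⁻¹ , pos ,
    trans (ℚ.*-assoc (½ ℚ.* ε) B⁻¹ B)
      (trans (cong (½ ℚ.* ε ℚ.*_) (ℚ.*-inverseˡ B)) (ℚ.*-identityʳ _))
    where
    instance
      B+ : ℚ.Positive B
      B+ = ℚ.positive 0<B
      B≢0 : ℚ.NonZero B
      B≢0 = ℚ.pos⇒nonZero B
      ε+ : ℚ.Positive (½ ℚ.* ε)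
      ε+ = ℚ.positive (half-pos 0<ε)
    B⁻¹ = ℚ.1/ B
    instance
      B⁻¹+ : ℚ.Positive B⁻¹
      B⁻¹+ = ℚ.1/pos⇒pos B
    pos : 0ℚ ℚ.< ½ ℚ.* ε ℚ.* B⁻¹
    pos = subst (ℚ._< ½ ℚ.* ε ℚ.* B⁻¹) (ℚ.*-zeroʳ (½ ℚ.* ε))
            (ℚ.*-monoʳ-<-pos (½ ℚ.* ε) (ℚ.positive⁻¹ B⁻¹))

  abs-*-< : ∀ {a b δ B η} → 0ℚ ℚ.< B → δ ℚ.* B ≡ η →
            ℚ.∣ a ∣ ℚ.< δ → ℚ.∣ b ∣ ℚ.≤ B → ℚ.∣ a ℚ.* b ∣ ℚ.< η
  abs-*-< {a} {b} {δ} {B} {η} 0<B δB≡η a<δ b≤B = begin-strict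
    ℚ.∣ a ℚ.* b ∣       ≡⟨ ℚ.∣p*q∣≡∣p∣*∣q∣ a b ⟩
    ℚ.∣ a ∣ ℚ.* ℚ.∣ b ∣ ≤⟨ ℚ.*-monoˡ-≤-nonNeg ℚ.∣ a ∣ {{ℚ.∣-∣-nonNeg a}} b≤B ⟩
    ℚ.∣ a ∣ ℚ.* B       <⟨ ℚ.*-monoˡ-<-pos B {{ℚ.positive 0<B}} a<δ ⟩
    δ ℚ.* B             ≡⟨ δB≡η ⟩
    η                   ∎
    where open ℚ.≤-Reasoning

  Bounded : (ℕ → ℚ) → ℚ → Set
  Bounded x B = Eventually (λ n → ℚ.∣ x n ∣ ℚ.≤ B)

  bound : ∀ x → ∃ λ B → 0ℚ ℚ.< B × Bounded (seq x) B
  bound x with cauchy x 1ℚ (ℚ.positive⁻¹ 1ℚ)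
  ... | N , h = 1ℚ ℚ.+ ℚ.∣ seq x N ∣
              , ℚ.+-mono-<-≤ (ℚ.positive⁻¹ 1ℚ) (ℚ.0≤∣p∣ (seq x N))
              , N , λ n N≤n → begin
    ℚ.∣ seq x n ∣
      ≡⟨ cong ℚ.∣_∣ (solve 2 (λ a b → a := (a :- b) :+ b) refl (seq x n) (seq x N)) ⟩
    ℚ.∣ (seq x n ℚ.- seq x N) ℚ.+ seq x N ∣
      ≤⟨ ℚ.∣p+q∣≤∣p∣+∣q∣ (seq x n ℚ.- seq x N) (seq x N) ⟩
    ℚ.∣ seq x n ℚ.- seq x N ∣ ℚ.+ ℚ.∣ seq x N ∣
      ≤⟨ ℚ.+-monoˡ-≤ _ (ℚ.<⇒≤ (h n N N≤n ℕ.≤-refl)) ⟩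
    1ℚ ℚ.+ ℚ.∣ seq x N ∣ ∎
    where open ℚ.≤-Reasoning

  widenˡ : ∀ B {C} → 0ℚ ℚ.< C → B ℚ.≤ B ℚ.+ C
  widenˡ B {C} 0<C =
    subst (ℚ._≤ B ℚ.+ C) (ℚ.+-identityʳ B) (ℚ.+-monoʳ-≤ B {0ℚ} {C} (ℚ.<⇒≤ 0<C))

  widenʳ : ∀ {B} C → 0ℚ ℚ.< B → C ℚ.≤ B ℚ.+ C
  widenʳ {B} C 0<B =
    subst (ℚ._≤ B ℚ.+ C) (ℚ.+-identityˡ C) (ℚ.+-monoˡ-≤ C {0ℚ} {B} (ℚ.<⇒≤ 0<B))

  commonBound : ∀ x y → ∃ λ B → 0ℚ ℚ.< B × Bounded (seq x) B × Bounded (seq y) B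
  commonBound x y = combine (bound x) (bound y)
    where
    combine : (∃ λ B → 0ℚ ℚ.< B × Bounded (seq x) B) →
              (∃ λ C → 0ℚ ℚ.< C × Bounded (seq y) C) →
              ∃ λ D → 0ℚ ℚ.< D × Bounded (seq x) D × Bounded (seq y) D
    combine (B , 0<B , M , hx) (C , 0<C , N , hy) =
      B ℚ.+ C , ℚ.<-≤-trans {0ℚ} {B} {B ℚ.+ C} 0<B (widenˡ B 0<C)
      , (M , λ n M≤n → ℚ.≤-trans {ℚ.∣ seq x n ∣} {B} {B ℚ.+ C} (hx n M≤n) (widenˡ B 0<C))
      , (N , λ n N≤n → ℚ.≤-trans {ℚ.∣ seq y n ∣} {C} {B ℚ.+ C} (hy n N≤n) (widenʳ C 0<B))

  ⊔ˡ : ∀ {m n k} → m ℕ.⊔ n ≤ k → m ≤ k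
  ⊔ˡ {m} {n} = ℕ.≤-trans (ℕ.m≤m⊔n m n)

  ⊔ʳ : ∀ {m n k} → m ℕ.⊔ n ≤ k → n ≤ k
  ⊔ʳ {m} {n} = ℕ.≤-trans (ℕ.m≤n⊔m m n)

  +-diff : ∀ a b c d → (a ℚ.+ b) ℚ.- (c ℚ.+ d) ≡ (a ℚ.- c) ℚ.+ (b ℚ.- d)
  +-diff = solve 4 (λ a b c d → (a :+ b) :- (c :+ d) := (a :- c) :+ (b :- d)) refl

  *-diff : ∀ a b c d → (a ℚ.* b) ℚ.- (c ℚ.* d) ≡ (a ℚ.- c) ℚ.* b ℚ.+ (b ℚ.- d) ℚ.* c
  *-diff = solve 4 (λ a b c d → (a :* b) :- (c :* d) := (a :- c) :* b :+ (b :- d) :* c) refl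

  neg-diff : ∀ a b → ℚ.∣ (ℚ.- a) ℚ.- (ℚ.- b) ∣ ≡ ℚ.∣ a ℚ.- b ∣
  neg-diff a b = trans (cong ℚ.∣_∣ (solve 2 (λ a b → (:- a) :- (:- b) := b :- a) refl a b))
    (-‿comm-abs b a)

  *-close : ∀ {ε B δ} → 0ℚ ℚ.< B → δ ℚ.* B ≡ ½ ℚ.* ε → ∀ a b c d →
            ℚ.∣ a ℚ.- c ∣ ℚ.< δ → ℚ.∣ b ℚ.- d ∣ ℚ.< δ →
            ℚ.∣ b ∣ ℚ.≤ B → ℚ.∣ c ∣ ℚ.≤ B → ℚ.∣ a ℚ.* b ℚ.- c ℚ.* d ∣ ℚ.< ε
  *-close {ε} {B} {δ} 0<B δB a b c d ac bd b≤B c≤B =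
    abs-split {a ℚ.* b ℚ.- c ℚ.* d} ((a ℚ.- c) ℚ.* b) ((b ℚ.- d) ℚ.* c) {ε}
      (*-diff a b c d)
      (abs-*-< {a ℚ.- c} {b} {δ} {B} {½ ℚ.* ε} 0<B δB ac b≤B)
      (abs-*-< {b ℚ.- d} {c} {δ} {B} {½ ℚ.* ε} 0<B δB bd c≤B)

fromℚ : ℚ → ℝ
fromℚ q = mkℝ (λ _ → q) λ ε 0<ε → 0 , λ _ _ _ _ →
  subst (ℚ._< ε) (sym (cong ℚ.∣_∣ (ℚ.+-inverseʳ q))) 0<ε

infixl 6 _+ᴿ_
infixl 7 _*ᴿ_
infix  8 -ᴿ_

_+ᴿ_ : ℝ → ℝ → ℝ
seq (x +ᴿ y) n = seq x n ℚ.+ seq y n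
cauchy (x +ᴿ y) ε 0<ε with cauchy x _ (half-pos 0<ε) | cauchy y _ (half-pos 0<ε)
... | M , hx | N , hy = M ℕ.⊔ N , λ m n p q →
  abs-split (seq x m ℚ.- seq x n) (seq y m ℚ.- seq y n)
    (+-diff (seq x m) (seq y m) (seq x n) (seq y n))
    (hx m n (⊔ˡ p) (⊔ˡ q)) (hy m n (⊔ʳ {M} p) (⊔ʳ {M} q))

-ᴿ_ : ℝ → ℝ
seq (-ᴿ x) n = ℚ.- seq x n
cauchy (-ᴿ x) ε 0<ε with cauchy x ε 0<ε
... | N , h = N , λ m n p q →
  subst (ℚ._< ε) (sym (neg-diff (seq x m) (seq x n))) (h m n p q)

∣_∣ᴿ : ℝ → ℝ
seq ∣ x ∣ᴿ n = ℚ.∣ seq x n ∣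
cauchy ∣ x ∣ᴿ ε 0<ε with cauchy x ε 0<ε
... | N , h = N , λ m n p q → ℚ.≤-<-trans (abs-lipschitz (seq x m) (seq x n)) (h m n p q)

_*ᴿ_ : ℝ → ℝ → ℝ
seq (x *ᴿ y) n = seq x n ℚ.* seq y n
cauchy (x *ᴿ y) ε 0<ε = bounded (commonBound x y)
  where
  Goal : Set
  Goal = ∃ λ N → ∀ m n → N ≤ m → N ≤ n →
    ℚ.∣ seq x m ℚ.* seq y m ℚ.- seq x n ℚ.* seq y n ∣ ℚ.< ε

  bounded : (∃ λ B → 0ℚ ℚ.< B × Bounded (seq x) B × Bounded (seq y) B) → Goal
  bounded (B , 0<B , (M , bx) , (N , by)) = scaled (scale ε B 0<ε 0<B)
    where
    scaled : (∃ λ δ → 0ℚ ℚ.< δ × δ ℚ.* B ≡ ½ ℚ.* ε) → Goal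
    scaled (δ , 0<δ , δB) with cauchy x δ 0<δ | cauchy y δ 0<δ
    ... | I , hx | J , hy = (M ℕ.⊔ N) ℕ.⊔ (I ℕ.⊔ J) , λ m n p q →
      let IJ≤m = ⊔ʳ {M ℕ.⊔ N} p
          IJ≤n = ⊔ʳ {M ℕ.⊔ N} q
      in *-close {ε} {B} {δ} 0<B δB (seq x m) (seq y m) (seq x n) (seq y n)
           (hx m n (⊔ˡ IJ≤m) (⊔ˡ IJ≤n)) (hy m n (⊔ʳ {I} IJ≤m) (⊔ʳ {I} IJ≤n))
           (by m (⊔ʳ {M} (⊔ˡ p))) (bx n (⊔ˡ (⊔ˡ {M ℕ.⊔ N} q)))

pointwise⇒≈ : ∀ {x y} → (∀ n → seq x n ≡ seq y n) → x ≈ᴿ y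
pointwise⇒≈ {x} {y} eq ε 0<ε = 0 , λ n _ → subst (ℚ._< ε)
  (sym (cong ℚ.∣_∣ (trans (cong (ℚ._- seq y n) (eq n)) (ℚ.+-inverseʳ (seq y n))))) 0<ε

≈ᴿ-isEquivalence : IsEquivalence _≈ᴿ_
≈ᴿ-isEquivalence = record
  { refl  = λ {x} → pointwise⇒≈ {x} {x} λ _ → refl
  ; sym   = λ {x} {y} x≈y ε 0<ε → case x≈y ε 0<ε of λ where
      (N , h) → N , λ n p → subst (ℚ._< ε) (-‿comm-abs (seq x n) (seq y n)) (h n p)
  ; trans = λ {x} {y} {z} x≈y y≈z ε 0<ε →
      case (x≈y _ (half-pos 0<ε) , y≈z _ (half-pos 0<ε)) of λ where
        ((M , h) , (N , k)) → M ℕ.⊔ N , λ n p →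
          abs-split (seq x n ℚ.- seq y n) (seq y n ℚ.- seq z n)
            (solve 3 (λ a b c → a :- c := (a :- b) :+ (b :- c)) refl
              (seq x n) (seq y n) (seq z n))
            (h n (⊔ˡ p)) (k n (⊔ʳ {M} p))
  }

+ᴿ-cong : ∀ {x x′ y y′} → x ≈ᴿ x′ → y ≈ᴿ y′ → x +ᴿ y ≈ᴿ x′ +ᴿ y′
+ᴿ-cong {x} {x′} {y} {y′} x≈x′ y≈y′ ε 0<ε
  with x≈x′ _ (half-pos 0<ε) | y≈y′ _ (half-pos 0<ε)
... | M , h | N , k = M ℕ.⊔ N , λ n p →
  abs-split (seq x n ℚ.- seq x′ n) (seq y n ℚ.- seq y′ n)
    (+-diff (seq x n) (seq y n) (seq x′ n) (seq y′ n)) (h n (⊔ˡ p)) (k n (⊔ʳ {M} p))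

-ᴿ-cong : ∀ {x y} → x ≈ᴿ y → -ᴿ x ≈ᴿ -ᴿ y
-ᴿ-cong {x} {y} x≈y ε 0<ε with x≈y ε 0<ε
... | N , h = N , λ n p → subst (ℚ._< ε) (sym (neg-diff (seq x n) (seq y n))) (h n p)

∣∣ᴿ-cong : ∀ {x y} → x ≈ᴿ y → ∣ x ∣ᴿ ≈ᴿ ∣ y ∣ᴿ
∣∣ᴿ-cong {x} {y} x≈y ε 0<ε with x≈y ε 0<ε
... | N , h = N , λ n p → ℚ.≤-<-trans (abs-lipschitz (seq x n) (seq y n)) (h n p)

*ᴿ-cong : ∀ {x x′ y y′} → x ≈ᴿ x′ → y ≈ᴿ y′ → x *ᴿ y ≈ᴿ x′ *ᴿ y′
*ᴿ-cong {x} {x′} {y} {y′} x≈x′ y≈y′ ε 0<ε = bounded (commonBound x′ y)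
  where
  Goal : Set
  Goal = Eventually λ n →
    ℚ.∣ seq x n ℚ.* seq y n ℚ.- seq x′ n ℚ.* seq y′ n ∣ ℚ.< ε

  bounded : (∃ λ B → 0ℚ ℚ.< B × Bounded (seq x′) B × Bounded (seq y) B) → Goal
  bounded (B , 0<B , (M , bx) , (N , by)) = scaled (scale ε B 0<ε 0<B)
    where
    scaled : (∃ λ δ → 0ℚ ℚ.< δ × δ ℚ.* B ≡ ½ ℚ.* ε) → Goal
    scaled (δ , 0<δ , δB) with x≈x′ δ 0<δ | y≈y′ δ 0<δ
    ... | I , h | J , k = (M ℕ.⊔ N) ℕ.⊔ (I ℕ.⊔ J) , λ n p →
      let IJ≤n = ⊔ʳ {M ℕ.⊔ N} p
      in *-close {ε} {B} {δ} 0<B δB (seq x n) (seq y n) (seq x′ n) (seq y′ n)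
           (h n (⊔ˡ IJ≤n)) (k n (⊔ʳ {I} IJ≤n))
           (by n (⊔ʳ {M} (⊔ˡ p))) (bx n (⊔ˡ (⊔ˡ {M ℕ.⊔ N} p)))

ℝ-commutativeRing : CommutativeRing 0ℓ 0ℓ
ℝ-commutativeRing = record
  { Carrier = ℝ ; _≈_ = _≈ᴿ_ ; _+_ = _+ᴿ_ ; _*_ = _*ᴿ_ ; -_ = -ᴿ_
  ; 0# = fromℚ 0ℚ ; 1# = fromℚ 1ℚ
  ; isCommutativeRing = record
    { isRing = record
      { +-isAbelianGroup = record
        { isGroup = record
          { isMonoid = record
            { isSemigroup = record
              { isMagma = record
                { isEquivalence = ≈ᴿ-isEquivalence
                ; ∙-cong = λ {x} {x′} {y} {y′} → +ᴿ-cong {x} {x′} {y} {y′} }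
              ; assoc = λ x y z → pointwise⇒≈ {(x +ᴿ y) +ᴿ z} {x +ᴿ (y +ᴿ z)}
                  λ n → ℚ.+-assoc (seq x n) (seq y n) (seq z n) }
            ; identity = (λ x → pointwise⇒≈ {fromℚ 0ℚ +ᴿ x} {x} λ n → ℚ.+-identityˡ (seq x n))
                       , (λ x → pointwise⇒≈ {x +ᴿ fromℚ 0ℚ} {x} λ n → ℚ.+-identityʳ (seq x n)) }
          ; inverse = (λ x → pointwise⇒≈ {(-ᴿ x) +ᴿ x} {fromℚ 0ℚ} λ n → ℚ.+-inverseˡ (seq x n))
                    , (λ x → pointwise⇒≈ {x +ᴿ (-ᴿ x)} {fromℚ 0ℚ} λ n → ℚ.+-inverseʳ (seq x n))
          ; ⁻¹-cong = λ {x} {y} → -ᴿ-cong {x} {y} }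
        ; comm = λ x y → pointwise⇒≈ {x +ᴿ y} {y +ᴿ x} λ n → ℚ.+-comm (seq x n) (seq y n) }
      ; *-cong = λ {x} {x′} {y} {y′} → *ᴿ-cong {x} {x′} {y} {y′}
      ; *-assoc = λ x y z → pointwise⇒≈ {(x *ᴿ y) *ᴿ z} {x *ᴿ (y *ᴿ z)}
          λ n → ℚ.*-assoc (seq x n) (seq y n) (seq z n)
      ; *-identity = (λ x → pointwise⇒≈ {fromℚ 1ℚ *ᴿ x} {x} λ n → ℚ.*-identityˡ (seq x n))
                   , (λ x → pointwise⇒≈ {x *ᴿ fromℚ 1ℚ} {x} λ n → ℚ.*-identityʳ (seq x n))
      ; distrib = (λ x y z → pointwise⇒≈ {x *ᴿ (y +ᴿ z)} {x *ᴿ y +ᴿ x *ᴿ z}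
                    λ n → ℚ.*-distribˡ-+ (seq x n) (seq y n) (seq z n))
                , (λ x y z → pointwise⇒≈ {(y +ᴿ z) *ᴿ x} {y *ᴿ x +ᴿ z *ᴿ x}
                    λ n → ℚ.*-distribʳ-+ (seq x n) (seq y n) (seq z n)) }
    ; *-comm = λ x y → pointwise⇒≈ {x *ᴿ y} {y *ᴿ x} λ n → ℚ.*-comm (seq x n) (seq y n) } }

module LinearAlgebra {c ℓ} (R : CommutativeRing c ℓ) where
  open CommutativeRing R hiding (refl; sym; trans; zero)
  open import Algebra.Properties.CommutativeMonoid.Sum +-commutativeMonoid public
    using (sum)
  open import Algebra.Properties.CommutativeMonoid.Sum *-commutativeMonoid public
    using () renaming (sum to product)
  open import Algebra.Properties.Semiring.Exp semiring using (_^_)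

  private variable k m n : ℕ

  Matrix : ℕ → ℕ → Set c
  Matrix m n = Fin m → Fin n → Carrier

  infix 4 _≋_
  _≋_ : Matrix m n → Matrix m n → Set ℓ
  A ≋ B = ∀ i j → A i j ≈ B i j

  infixl 7 _⊗_
  _⊗_ : Matrix k m → Matrix m n → Matrix k n
  (A ⊗ B) i j = sum λ l → A i l * B l j

  infixl 6 _⊖_
  _⊖_ : Matrix m n → Matrix m n → Matrix m n
  (A ⊖ B) i j = A i j - B i j

  infix 9 _ᵀ
  _ᵀ : Matrix m n → Matrix n m
  (A ᵀ) i j = A j i

  diagonal : Vector Carrier n → Matrix n n
  diagonal d i j = if does (i Fin.≟ j) then d i else 0#

  det : ∀ {n} → Matrix n n → Carrier
  det {zero}  A = 1#
  det {suc n} A = sum λ j →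
    (- 1#) ^ toℕ j * A zero j * det (λ i l → A (suc i) (punchIn j l))

  -- The eigenvalues listed with algebraic multiplicity:
  -- det (x I − A) = ∏ᵢ (x − λᵢ) for all x.  Over an infinite domain such as ℝ
  -- this is the factorisation of the characteristic polynomial.
  AreEigenvalues : Matrix n n → Vector Carrier n → Set (c ⊔ ℓ)
  AreEigenvalues A λs =
    ∀ x → det (diagonal (λ _ → x) ⊖ A) ≈ product (λ i → x - λs i)

  -- The Penrose conditions.  The adjoint is the plain transpose, which is
  -- the right notion only for real scalars.
  record IsMoorePenroseInverse (A : Matrix m n) (X : Matrix n m) : Set (c ⊔ ℓ) where
    field
      AXA≋A : A ⊗ X ⊗ A ≋ A
      XAX≋X : X ⊗ A ⊗ X ≋ X
      AX-symmetric : (A ⊗ X) ᵀ ≋ A ⊗ X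
      XA-symmetric : (X ⊗ A) ᵀ ≋ X ⊗ A

record Graph (m : ℕ) : Set₁ where
  infix 4 _~_ _~?_
  field
    _~_    : Rel (Fin m) 0ℓ
    _~?_   : Decidable _~_
    irrefl : Irreflexive _≡_ _~_
    symm   : Symmetric _~_

K : ∀ n → Graph n
K n = record
  { _~_    = _≢_
  ; _~?_   = λ i j → ¬? (i Fin.≟ j)
  ; irrefl = λ i≡j i≢j → i≢j i≡j
  ; symm   = ≢-sym
  }

-- The cartesian product; Fin (m * k) encodes Fin m × Fin k through remQuot.
infixl 7 _□_
_□_ : ∀ {m k} → Graph m → Graph k → Graph (m ℕ.* k)
_□_ {m} {k} G H = record
  { _~_    = λ x y → Adj (remQuot k x) (remQuot k y)
  ; _~?_   = λ x y → Adj? (remQuot k x) (remQuot k y)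
  ; irrefl = λ where
      refl (inj₁ (_ , u~u)) → Graph.irrefl H refl u~u
      refl (inj₂ (_ , v~v)) → Graph.irrefl G refl v~v
  ; symm   = λ where
      (inj₁ (v≡v′ , u~u′)) → inj₁ (sym v≡v′ , Graph.symm H u~u′)
      (inj₂ (u≡u′ , v~v′)) → inj₂ (sym u≡u′ , Graph.symm G v~v′)
  }
  where
  Adj : Rel (Fin m × Fin k) 0ℓ
  Adj (v₁ , u₁) (v₂ , u₂) =
    (v₁ ≡ v₂ × Graph._~_ H u₁ u₂) ⊎ (u₁ ≡ u₂ × Graph._~_ G v₁ v₂)

  Adj? : Decidable Adj
  Adj? (v₁ , u₁) (v₂ , u₂) =
    ((v₁ Fin.≟ v₂) ×-dec Graph._~?_ H u₁ u₂) ⊎-dec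
    ((u₁ Fin.≟ u₂) ×-dec Graph._~?_ G v₁ v₂)

open LinearAlgebra ℝ-commutativeRing public
open CommutativeRing ℝ-commutativeRing public using (0#; 1#) renaming (_-_ to infixl 6 _-ᴿ_)

module _ {m : ℕ} (G : Graph m) where
  open Graph G

  Connected : Set
  Connected = ∀ i j → Star _~_ i j

  degree : Fin m → ℕ
  degree i = length (filter (i ~?_) (allFin m))

  degreeMatrix : Matrix m m
  degreeMatrix = diagonal λ i → fromℚ (ℤ.+ degree i ℚ./ 1)

  adjacencyMatrix : Matrix m m
  adjacencyMatrix i j = if does (i ~? j) then 1# else 0#

  laplacian : Matrix m m
  laplacian = degreeMatrix ⊖ adjacencyMatrix

resistanceMatrix : ∀ {m} → Matrix m m → Matrix m m
resistanceMatrix L† i j = L† i i +ᴿ L† j j -ᴿ fromℚ (ℤ.+ 2 ℚ./ 1) *ᴿ L† i j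

-- E_R(G) = e.  This is a relation because neither L† nor the eigenvalues are
-- given as functions here; both are determined by G (the latter up to order).
record ResistanceEnergy {m} (G : Graph m) (e : ℝ) : Set where
  field
    connected           : Connected G
    L†                  : Matrix m m
    L†-isMoorePenrose   : IsMoorePenroseInverse (laplacian G) L†
    eigenvalues         : Vector ℝ m
    eigenvalues-correct : AreEigenvalues (resistanceMatrix L†) eigenvalues
    energy              : sum (λ i → ∣ eigenvalues i ∣ᴿ) ≈ᴿ e

instance
  n[n+2]-nonZero : ∀ {n} .{{_ : ℕ.NonZero n}} → ℕ.NonZero (n ℕ.* (n ℕ.+ 2))
  n[n+2]-nonZero {suc _} = _

{-# OPTIONS --safe #-}
module Submission where

-- Write J for a matrix of ones.  Every matrix in sight is invariant under permuting the
-- vertices of K n and those of K 2, so it is a combination of the four products of a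
-- projection on the first factor with one on the second, where the projections of a
-- complete graph on m vertices are J/m (onto the constants) and I - J/m (onto the vectors
-- of sum zero).  Such a matrix is given by its four eigenvalues (gridForm), and these
-- multiply under matrix multiplication (gridForm-⊗).
--
-- On the four common eigenspaces, of dimensions 1, 1, n - 1 and n - 1, the Laplacian has
-- the eigenvalues 0, 2, n, n + 2.  Hence its Moore-Penrose inverse has the eigenvalues 0,
-- 1/2, 1/n, 1/(n + 2), and the resistance matrix 2c J - 2 L†, with c the common diagonal
-- entry of L†, has the eigenvalues 1 + 2 (n - 1) (1/n + 1/(n + 2)), -1, -2/n and
-- -2/(n + 2).  The first is the only positive one and the trace vanishes, so the energy
-- is twice the first, 2 + 4 (n - 1) (1/n + 1/(n + 2)), which is the stated fraction.
--
-- Multiplicities are read off the characteristic polynomial.  A basis that begins with the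
-- constant vector brings the resistance matrix R to triangular form, R P = P T with P unit
-- lower triangular and T upper triangular, and then det (x I - R) is the product of the
-- x - T i i (triangularised⇒eigenvalues).  This uses only one case of multiplicativity,
-- det (A P) = det A times the product of the P i i for triangular P (det-⊗-triangular),
-- which follows from the determinant being linear and alternating in the columns.
--
-- Apart from the variable x all entries are rational, so the identities of matrices are
-- proved over the rationals and transported to the reals termwise.

open import Algebra.Bundles using (CommutativeRing)
open import Data.Bool.Base using (Bool; true; false; if_then_else_; _∧_; _∨_; not)
open import Data.Fin.Base as Fin using (Fin; zero; suc; toℕ; inject₁; punchIn; punchOut;
  combine; remQuot; quotient; remainder; _↑ˡ_; _↑ʳ_)
import Data.Fin.Properties as Fin
import Data.Integer.Base as ℤ
import Data.Integer.Properties as ℤ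
open import Data.List.Base using (length; filter; tabulate)
open import Data.Nat.Base as ℕ using (ℕ; zero; suc)
import Data.Nat.Properties as ℕ
open import Data.Product.Base using (_×_; _,_; ∃; proj₁; proj₂)
open import Data.Rational.Base as ℚ using (ℚ; 0ℚ; 1ℚ; ½)
import Data.Rational.Properties as ℚ
open import Data.Rational.Solver using (module +-*-Solver)
import Data.Rational.Unnormalised.Base as ℚᵘ
import Data.Rational.Unnormalised.Properties as ℚᵘ
open import Data.Sum.Base using (_⊎_; inj₁; inj₂; [_,_]′)
open import Data.Vec.Functional using (Vector)
open import Function.Base using (_∘_)
open import Relation.Binary.Construct.Closure.ReflexiveTransitive using (Star; ε; _◅_; _◅◅_; gmap)
open import Relation.Binary.Definitions using (tri<; tri≈; tri>)
open import Relation.Binary.PropositionalEquality as ≡ using (_≡_; _≢_)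
open import Relation.Nullary.Decidable using (does; yes; no; dec-true; dec-false)
open import Relation.Nullary.Negation.Core using (contradiction)
open import Relation.Unary using (Pred; Decidable)
open import Defs using (module LinearAlgebra)

-- Determinants over a commutative ring.

module Determinant {c ℓ} (R : CommutativeRing c ℓ) where
  open CommutativeRing R hiding (zero)
  open LinearAlgebra R
  open import Algebra.Properties.Semiring.Exp semiring using (_^_)
  open import Algebra.Properties.Ring ring using (-‿distribˡ-*; -‿distribʳ-*; -1*x≈-x; -0#≈0#)
  open import Algebra.Properties.AbelianGroup +-abelianGroup using (⁻¹-∙-comm)
  open import Algebra.Properties.CommutativeMonoid.Sum +-commutativeMonoid
    using (sum-cong-≋; sum-remove; sum-replicate-zero; ∑-comm; ∑-distrib-+)
  open import Algebra.Properties.Semiring.Sum semiring using (*-distribˡ-sum; *-distribʳ-sum)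
  module Product where
    open import Algebra.Properties.CommutativeMonoid.Sum *-commutativeMonoid public
      using (sum-cong-≋; sum-remove)
  open import Algebra.Solver.CommutativeMonoid *-commutativeMonoid using (solve; _⊕_; _⊜_)
  open import Relation.Binary.Reasoning.Setoid setoid

  private variable k m n : ℕ

  sum-zero : (f : Vector Carrier n) → (∀ i → f i ≈ 0#) → sum f ≈ 0#
  sum-zero {n} f f≈0 = trans (sum-cong-≋ f≈0) (sum-replicate-zero n)

  sum-single : (f : Vector Carrier n) (i : Fin n) → (∀ j → j ≢ i → f j ≈ 0#) → sum f ≈ f i
  sum-single {suc n} f i f≈0 = begin
    sum f                        ≈⟨ sum-remove {i = i} f ⟩
    f i + sum (f ∘ punchIn i)    ≈⟨ +-congˡ (sum-zero _ λ j → f≈0 _ (Fin.punchInᵢ≢i i j)) ⟩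
    f i + 0#                     ≈⟨ +-identityʳ _ ⟩
    f i                          ∎

  product-1 : {f : Vector Carrier n} → (∀ j → f j ≈ 1#) → product f ≈ 1#
  product-1 {zero}  f≈1 = refl
  product-1 {suc n} f≈1 = trans (*-cong (f≈1 zero) (product-1 (f≈1 ∘ suc))) (*-identityˡ 1#)

  product-rescale : (k : Fin n) {x : Carrier} {f g : Vector Carrier n} →
    (∀ j → j ≢ k → f j ≈ g j) → f k ≈ x → g k ≈ 1# → product f ≈ x * product g
  product-rescale {suc n} k {x} {f} {g} off fk gk = begin
    product f
      ≈⟨ Product.sum-remove {i = k} f ⟩
    f k * product (f ∘ punchIn k)
      ≈⟨ *-cong fk (Product.sum-cong-≋ λ j → off _ (Fin.punchInᵢ≢i k j)) ⟩
    x * product (g ∘ punchIn k)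
      ≈⟨ *-congˡ (trans (*-congʳ gk) (*-identityˡ _)) ⟨
    x * (g k * product (g ∘ punchIn k))
      ≈⟨ *-congˡ (Product.sum-remove {i = k} g) ⟨
    x * product g ∎

  -- A with row 0 and column j deleted.
  minor : Fin (suc n) → Matrix (suc n) (suc n) → Matrix n n
  minor j A i l = A (suc i) (punchIn j l)

  det-cong : {A B : Matrix n n} → A ≋ B → det A ≈ det B
  det-cong {zero}  A≋B = refl
  det-cong {suc n} A≋B = sum-cong-≋ λ j →
    *-cong (*-congˡ {(- 1#) ^ toℕ j} (A≋B zero j)) (det-cong λ i l → A≋B (suc i) (punchIn j l))

  -- Linearity in column k: away from k the columns of A are those of every B l, and
  -- column k of A is the combination, with coefficients p l, of the columns k of the B l.
  det-linear : (k : Fin n) (p : Vector Carrier m) (A : Matrix n n) (B : Fin m → Matrix n n) →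
    (∀ l i j → j ≢ k → A i j ≈ B l i j) →
    (∀ i → A i k ≈ sum λ l → p l * B l i k) →
    det A ≈ sum λ l → p l * det (B l)
  det-linear {suc n} {m} k p A B off at = begin
    det A
      ≈⟨ sum-cong-≋ term ⟩
    (sum λ j → sum λ l → p l * expand (B l) j)
      ≈⟨ ∑-comm (λ j l → p l * expand (B l) j) ⟩
    (sum λ l → sum λ j → p l * expand (B l) j)
      ≈⟨ sum-cong-≋ (λ l → *-distribˡ-sum (p l) (expand (B l))) ⟨
    (sum λ l → p l * det (B l)) ∎
    where
    expand : Matrix (suc n) (suc n) → Fin (suc n) → Carrier
    expand C j = (- 1#) ^ toℕ j * C zero j * det (minor j C)

    term : ∀ j → expand A j ≈ sum λ l → p l * expand (B l) j
    term j with j Fin.≟ k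
    ... | yes ≡.refl = begin
      s * A zero k * d
        ≈⟨ *-congʳ (trans (*-congˡ (at zero)) (*-distribˡ-sum {m} s (λ l → p l * B l zero k))) ⟩
      sum (λ l → s * (p l * B l zero k)) * d
        ≈⟨ *-distribʳ-sum {m} d (λ l → s * (p l * B l zero k)) ⟩
      sum (λ l → s * (p l * B l zero k) * d)
        ≈⟨ sum-cong-≋ (λ l → trans
             (solve 4 (λ s p b d → (s ⊕ (p ⊕ b)) ⊕ d ⊜ p ⊕ ((s ⊕ b) ⊕ d)) refl s (p l) (B l zero k) d)
             (*-congˡ (*-congˡ (det-cong λ i j → off l (suc i) (punchIn k j) (Fin.punchInᵢ≢i k j))))) ⟩
      sum (λ l → p l * expand (B l) k) ∎
      where
      s = (- 1#) ^ toℕ k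
      d = det (minor k A)
    ... | no j≢k = begin
      s * A zero j * det (minor j A)
        ≈⟨ *-congˡ (det-linear k′ p (minor j A) (minor j ∘ B) off′ at′) ⟩
      s * A zero j * sum (λ l → p l * det (minor j (B l)))
        ≈⟨ *-distribˡ-sum {m} (s * A zero j) (λ l → p l * det (minor j (B l))) ⟩
      sum (λ l → s * A zero j * (p l * det (minor j (B l))))
        ≈⟨ sum-cong-≋ (λ l → trans
             (solve 4 (λ s a p d → (s ⊕ a) ⊕ (p ⊕ d) ⊜ p ⊕ ((s ⊕ a) ⊕ d)) refl s (A zero j) (p l) _)
             (*-congˡ (*-congʳ (*-congˡ (off l zero j j≢k))))) ⟩
      sum (λ l → p l * expand (B l) j) ∎
      where
      s = (- 1#) ^ toℕ j
      k′ = punchOut j≢k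
      k′↦k : punchIn j k′ ≡ k
      k′↦k = Fin.punchIn-punchOut j≢k
      off′ : ∀ l i q → q ≢ k′ → minor j A i q ≈ minor j (B l) i q
      off′ l i q q≢k′ = off l (suc i) (punchIn j q) λ eq →
        q≢k′ (Fin.punchIn-injective j q k′ (≡.trans eq (≡.sym k′↦k)))
      at′ : ∀ i → minor j A i k′ ≈ sum λ l → p l * minor j (B l) i k′
      at′ i = ≡.subst (λ q → A (suc i) q ≈ sum λ l → p l * B l (suc i) q) (≡.sym k′↦k) (at (suc i))

  -- Deleting a third index j keeps the adjacent indices k and k + 1 adjacent.
  adjacent-punchOut : (k : Fin (suc n)) (j : Fin (suc (suc n))) → j ≢ inject₁ k → j ≢ suc k →
    ∃ λ k′ → punchIn j (inject₁ k′) ≡ inject₁ k × punchIn j (suc k′) ≡ suc k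
  adjacent-punchOut zero zero j≢k _ = contradiction ≡.refl j≢k
  adjacent-punchOut {suc n} (suc k) zero _ _ = k , ≡.refl , ≡.refl
  adjacent-punchOut zero (suc zero) _ j≢k+1 = contradiction ≡.refl j≢k+1
  adjacent-punchOut {suc n} zero (suc (suc j)) _ _ = zero , ≡.refl , ≡.refl
  adjacent-punchOut {suc n} (suc k) (suc j) j≢k j≢k+1
    with k′ , eq , eq′ ← adjacent-punchOut k j (j≢k ∘ ≡.cong suc) (j≢k+1 ∘ ≡.cong suc)
    = suc k′ , ≡.cong suc eq , ≡.cong suc eq′

  punchIn-inject₁ : (k : Fin n) → punchIn (inject₁ k) k ≡ suc k
  punchIn-inject₁ zero    = ≡.refl
  punchIn-inject₁ (suc k) = ≡.cong suc (punchIn-inject₁ k)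

  punchIn-suc : (k : Fin n) → punchIn (suc k) k ≡ inject₁ k
  punchIn-suc zero    = ≡.refl
  punchIn-suc (suc k) = ≡.cong suc (punchIn-suc k)

  punchIn-adjacent : (k m : Fin n) → m ≢ k → punchIn (inject₁ k) m ≡ punchIn (suc k) m
  punchIn-adjacent zero    zero    m≢k = contradiction ≡.refl m≢k
  punchIn-adjacent zero    (suc m) m≢k = ≡.refl
  punchIn-adjacent (suc k) zero    m≢k = ≡.refl
  punchIn-adjacent (suc k) (suc m) m≢k = ≡.cong suc (punchIn-adjacent k m (m≢k ∘ ≡.cong suc))

  -- In the expansion along row 0, deleting any other column leaves two equal adjacent
  -- columns, and the two remaining terms have equal minors and opposite signs.
  det-adjacent : (A : Matrix (suc n) (suc n)) (k : Fin n) →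
    (∀ i → A i (inject₁ k) ≈ A i (suc k)) → det A ≈ 0#
  det-adjacent {suc n} A k eq = begin
    det A
      ≈⟨ sum-remove {i = inject₁ k} (λ j → expand j) ⟩
    expand (inject₁ k) + sum (expand ∘ punchIn (inject₁ k))
      ≈⟨ +-congˡ (sum-single (expand ∘ punchIn (inject₁ k)) k other) ⟩
    expand (inject₁ k) + expand (punchIn (inject₁ k) k)
      ≡⟨ ≡.cong (λ j → expand (inject₁ k) + expand j) (punchIn-inject₁ k) ⟩
    expand (inject₁ k) + expand (suc k)
      ≈⟨ +-congˡ (*-cong (*-congˡ (eq zero)) (det-cong same-minor)) ⟨
    expand (inject₁ k) + (- 1#) ^ toℕ (suc k) * a * d
      ≡⟨ ≡.cong (λ t → (- 1#) ^ t * a * d + (- 1#) ^ suc (toℕ k) * a * d) (Fin.toℕ-inject₁ k) ⟩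
    s * a * d + - 1# * s * a * d
      ≈⟨ +-congˡ (solve 4 (λ e s a d → ((e ⊕ s) ⊕ a) ⊕ d ⊜ e ⊕ ((s ⊕ a) ⊕ d)) refl (- 1#) s a d) ⟩
    s * a * d + - 1# * (s * a * d)
      ≈⟨ +-congˡ (-1*x≈-x _) ⟩
    s * a * d + - (s * a * d)
      ≈⟨ -‿inverseʳ _ ⟩
    0# ∎
    where
    expand : Fin (suc (suc n)) → Carrier
    expand j = (- 1#) ^ toℕ j * A zero j * det (minor j A)
    s = (- 1#) ^ toℕ k
    a = A zero (inject₁ k)
    d = det (minor (inject₁ k) A)

    same-minor : minor (inject₁ k) A ≋ minor (suc k) A
    same-minor i m with m Fin.≟ k
    ... | yes ≡.refl = begin
      A (suc i) (punchIn (inject₁ k) k) ≡⟨ ≡.cong (A (suc i)) (punchIn-inject₁ k) ⟩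
      A (suc i) (suc k)                 ≈⟨ eq (suc i) ⟨
      A (suc i) (inject₁ k)             ≡⟨ ≡.cong (A (suc i)) (punchIn-suc k) ⟨
      A (suc i) (punchIn (suc k) k)     ∎
    ... | no m≢k = reflexive (≡.cong (A (suc i)) (punchIn-adjacent k m m≢k))

    other : ∀ m → m ≢ k → expand (punchIn (inject₁ k) m) ≈ 0#
    other m m≢k
      with k′ , eq₁ , eq₂ ← adjacent-punchOut k (punchIn (inject₁ k) m)
             (Fin.punchInᵢ≢i (inject₁ k) m)
             (λ j≡k+1 → m≢k (Fin.punchIn-injective (inject₁ k) m k
                (≡.trans j≡k+1 (≡.sym (punchIn-inject₁ k)))))
      = trans (*-congˡ (det-adjacent (minor _ A) k′ λ i → begin
          A (suc i) _             ≡⟨ ≡.cong (A (suc i)) eq₁ ⟩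
          A (suc i) (inject₁ k)   ≈⟨ eq (suc i) ⟩
          A (suc i) (suc k)       ≡⟨ ≡.cong (A (suc i)) eq₂ ⟨
          A (suc i) _             ∎)) (zeroʳ _)

  det-additive : (k : Fin n) (A B C : Matrix n n) →
    (∀ i j → j ≢ k → A i j ≈ B i j) → (∀ i j → j ≢ k → A i j ≈ C i j) →
    (∀ i → A i k ≈ B i k + C i k) → det A ≈ det B + det C
  det-additive {n} k A B C offB offC at = trans
    (det-linear {m = 2} k (λ _ → 1#) A pair off λ i → trans (at i) (sym (two (B i k) (C i k))))
    (two (det B) (det C))
    where
    pair : Fin 2 → Matrix n n
    pair zero    = B
    pair (suc _) = C
    off : ∀ l i j → j ≢ k → A i j ≈ pair l i j
    off zero       = offB
    off (suc zero) = offC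
    two : ∀ x y → 1# * x + (1# * y + 0#) ≈ x + y
    two x y = +-cong (*-identityˡ x) (trans (+-identityʳ _) (*-identityˡ y))

  -- The transposition of i and j.
  transpose : Fin n → Fin n → Fin n → Fin n
  transpose i j l = if does (l Fin.≟ i) then j else if does (l Fin.≟ j) then i else l

  transpose-other : (i j : Fin n) {l : Fin n} → l ≢ i → l ≢ j → transpose i j l ≡ l
  transpose-other i j {l} l≢i l≢j with l Fin.≟ i | l Fin.≟ j
  ... | yes l≡i | _       = contradiction l≡i l≢i
  ... | no _    | yes l≡j = contradiction l≡j l≢j
  ... | no _    | no _    = ≡.refl

  transpose-first : (i j : Fin n) → transpose i j i ≡ j
  transpose-first i j with i Fin.≟ i
  ... | yes _  = ≡.refl
  ... | no i≢i = contradiction ≡.refl i≢i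

  inject₁≢suc : (k : Fin n) → inject₁ k ≢ suc k
  inject₁≢suc (suc k) eq = inject₁≢suc k (Fin.suc-injective eq)

  -- Polarisation: put the sum of columns p and q in both places and expand.
  det-transpose : {p q : Fin n} → p ≢ q →
    (∀ B → (∀ i → B i p ≈ B i q) → det B ≈ 0#) →
    (A : Matrix n n) → det A + det (λ i j → A i (transpose p q j)) ≈ 0#
  det-transpose {n} {p} {q} p≢q vanishes A = begin
    det A + det (λ i j → A i (transpose p q j))
      ≈⟨ +-cong (det-cong original) (det-cong exchanged) ⟩
    det (place u w) + det (place w u)
      ≈⟨ +-cong (+-identityˡ _) (+-identityʳ _) ⟨
    (0# + det (place u w)) + (det (place w u) + 0#)
      ≈⟨ +-cong (+-congʳ (diagonal-zero u)) (+-congˡ (diagonal-zero w)) ⟨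
    (det (place u u) + det (place u w)) + (det (place w u) + det (place w w))
      ≈⟨ +-cong (additiveʳ u) (additiveʳ w) ⟨
    det (place u (λ i → u i + w i)) + det (place w (λ i → u i + w i))
      ≈⟨ additiveˡ (λ i → u i + w i) ⟨
    det (place (λ i → u i + w i) (λ i → u i + w i))
      ≈⟨ diagonal-zero (λ i → u i + w i) ⟩
    0# ∎
    where
    u w : Vector Carrier n
    u i = A i p
    w i = A i q

    place : Vector Carrier n → Vector Carrier n → Matrix n n
    place x y i j = if does (j Fin.≟ p) then x i else if does (j Fin.≟ q) then y i else A i j

    place-p : ∀ x y i → place x y i p ≡ x i
    place-p x y i with p Fin.≟ p
    ... | yes _  = ≡.refl
    ... | no p≢p = contradiction ≡.refl p≢p

    place-q : ∀ x y i → place x y i q ≡ y i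
    place-q x y i with q Fin.≟ p | q Fin.≟ q
    ... | yes q≡p | _       = contradiction (≡.sym q≡p) p≢q
    ... | no _    | yes _   = ≡.refl
    ... | no _    | no q≢q = contradiction ≡.refl q≢q

    place-offˡ : ∀ x x′ y i j → j ≢ p → place x y i j ≈ place x′ y i j
    place-offˡ x x′ y i j j≢p with j Fin.≟ p
    ... | yes j≡p = contradiction j≡p j≢p
    ... | no _    = refl

    place-offʳ : ∀ x y y′ i j → j ≢ q → place x y i j ≈ place x y′ i j
    place-offʳ x y y′ i j j≢q with j Fin.≟ p | j Fin.≟ q
    ... | yes _ | _       = refl
    ... | no _  | yes j≡q = contradiction j≡q j≢q
    ... | no _  | no _    = refl

    diagonal-zero : ∀ x → det (place x x) ≈ 0#
    diagonal-zero x = vanishes (place x x) λ i →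
      reflexive (≡.trans (place-p x x i) (≡.sym (place-q x x i)))

    additiveˡ : ∀ y → det (place (λ i → u i + w i) y) ≈ det (place u y) + det (place w y)
    additiveˡ y = det-additive p _ _ _ (place-offˡ _ u y) (place-offˡ _ w y) λ i →
      reflexive (≡.trans (place-p (λ i → u i + w i) y i)
        (≡.sym (≡.cong₂ _+_ (place-p u y i) (place-p w y i))))

    additiveʳ : ∀ x → det (place x (λ i → u i + w i)) ≈ det (place x u) + det (place x w)
    additiveʳ x = det-additive q _ _ _ (place-offʳ x _ u) (place-offʳ x _ w) λ i →
      reflexive (≡.trans (place-q x (λ i → u i + w i) i)
        (≡.sym (≡.cong₂ _+_ (place-q x u i) (place-q x w i))))

    original : A ≋ place u w
    original i j with j Fin.≟ p | j Fin.≟ q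
    ... | yes ≡.refl | _          = refl
    ... | no _       | yes ≡.refl = refl
    ... | no _       | no _       = refl

    exchanged : (λ i j → A i (transpose p q j)) ≋ place w u
    exchanged i j with j Fin.≟ p | j Fin.≟ q
    ... | yes ≡.refl | _          = refl
    ... | no _       | yes ≡.refl = refl
    ... | no _       | no _       = refl

  -- Equal columns p < q, by induction on t = q: if they are not adjacent, exchanging
  -- columns q - 1 and q moves the second one closer to the first.
  det-alternating-< : ∀ t (A : Matrix n n) (p q : Fin n) → toℕ q ≡ t → toℕ p ℕ.< toℕ q →
    (∀ i → A i p ≈ A i q) → det A ≈ 0#
  det-alternating-< (suc t) A p (suc k) q≡t p<q eq with p Fin.≟ inject₁ k
  ... | yes ≡.refl = det-adjacent A k eq
  ... | no p≢k = begin
    det A         ≈⟨ +-identityʳ _ ⟨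
    det A + 0#    ≈⟨ +-congˡ (det-alternating-< t B p (inject₁ k)
                       (≡.trans (Fin.toℕ-inject₁ k) (ℕ.suc-injective q≡t)) p<k eq′) ⟨
    det A + det B ≈⟨ det-transpose (inject₁≢suc k) (λ C → det-adjacent C k) A ⟩
    0#            ∎
    where
    B : Matrix _ _
    B i j = A i (transpose (inject₁ k) (suc k) j)
    p<k : toℕ p ℕ.< toℕ (inject₁ k)
    p<k = ℕ.≤∧≢⇒< (≡.subst (toℕ p ℕ.≤_) (≡.sym (Fin.toℕ-inject₁ k)) (ℕ.s≤s⁻¹ p<q))
                  (p≢k ∘ Fin.toℕ-injective)
    eq′ : ∀ i → B i p ≈ B i (inject₁ k)
    eq′ i = trans (reflexive (≡.cong (A i) (transpose-other (inject₁ k) (suc k) p≢k λ where ≡.refl → ℕ.<-irrefl ≡.refl p<q)))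
      (trans (eq i) (reflexive (≡.cong (A i) (≡.sym (transpose-first (inject₁ k) (suc k))))))

  det-alternating : (A : Matrix n n) {p q : Fin n} → p ≢ q → (∀ i → A i p ≈ A i q) → det A ≈ 0#
  det-alternating A {p} {q} p≢q eq with Fin.<-cmp p q
  ... | tri< p<q _ _ = det-alternating-< _ A p q ≡.refl p<q eq
  ... | tri≈ _ p≡q _ = contradiction p≡q p≢q
  ... | tri> _ _ q<p = det-alternating-< _ A q p ≡.refl q<p (sym ∘ eq)

  -- Replacing column k by a combination of all columns multiplies the determinant by
  -- the coefficient of column k.
  det-column : (k : Fin n) (p : Vector Carrier n) (A B : Matrix n n) →
    (∀ i j → j ≢ k → B i j ≈ A i j) → (∀ i → B i k ≈ sum λ l → p l * A i l) →
    det B ≈ p k * det A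
  det-column {n} k p A B off at = begin
    det B
      ≈⟨ det-linear k p B replaced
           (λ l i j j≢k → trans (off i j j≢k) (sym (replaced-off l i j j≢k)))
           (λ i → trans (at i) (sum-cong-≋ λ l → *-congˡ (sym (replaced-at l i)))) ⟩
    sum (λ l → p l * det (replaced l))
      ≈⟨ sum-single (λ l → p l * det (replaced l)) k (λ l l≢k → trans (*-congˡ (repeated l l≢k)) (zeroʳ (p l))) ⟩
    p k * det (replaced k)
      ≈⟨ *-congˡ (det-cong unchanged) ⟩
    p k * det A ∎
    where
    replaced : Fin n → Matrix n n
    replaced l i j = if does (j Fin.≟ k) then A i l else A i j

    replaced-off : ∀ l i j → j ≢ k → replaced l i j ≈ A i j
    replaced-off l i j j≢k with j Fin.≟ k
    ... | yes j≡k = contradiction j≡k j≢k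
    ... | no _    = refl

    replaced-at : ∀ l i → replaced l i k ≈ A i l
    replaced-at l i with k Fin.≟ k
    ... | yes _  = refl
    ... | no k≢k = contradiction ≡.refl k≢k

    repeated : ∀ l → l ≢ k → det (replaced l) ≈ 0#
    repeated l l≢k = det-alternating (replaced l) l≢k λ i →
      trans (replaced-off l i l l≢k) (sym (replaced-at l i))

    unchanged : replaced k ≋ A
    unchanged i j with j Fin.≟ k
    ... | yes ≡.refl = refl
    ... | no _       = refl

  -- P is triangular in the order of its indices given by the ranking r.  Lower and upper
  -- triangular matrices are the cases of an increasing and a decreasing ranking.
  module _ {n} (r : Fin n → ℕ) (r-injective : ∀ {i j} → r i ≡ r j → i ≡ j)
           (A P : Matrix n n) (triangular : ∀ {i j} → r i ℕ.< r j → P i j ≈ 0#) where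

    private
      -- The columns of rank below s have been replaced by those of A ⊗ P.  Step s only
      -- involves columns not yet replaced, because P is triangular.
      stage : ℕ → Matrix n n
      stage s i j = if does (r j ℕ.<? s) then (A ⊗ P) i j else A i j

      -- The factors P j j accumulated before step s, padded with ones.
      pivot : ℕ → Vector Carrier n
      pivot s j = if does (r j ℕ.<? s) then P j j else 1#

      stage-< : ∀ s i {j} → r j ℕ.< s → stage s i j ≡ (A ⊗ P) i j
      stage-< s i {j} r<s = ≡.cong (λ b → if b then (A ⊗ P) i j else A i j) (dec-true (r j ℕ.<? s) r<s)

      stage-≥ : ∀ s i {j} → s ℕ.≤ r j → stage s i j ≡ A i j
      stage-≥ s i {j} s≤r = ≡.cong (λ b → if b then (A ⊗ P) i j else A i j) (dec-false (r j ℕ.<? s) (ℕ.≤⇒≯ s≤r))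

      pivot-< : ∀ s {j} → r j ℕ.< s → pivot s j ≡ P j j
      pivot-< s {j} r<s = ≡.cong (λ b → if b then P j j else 1#) (dec-true (r j ℕ.<? s) r<s)

      pivot-≥ : ∀ s {j} → s ℕ.≤ r j → pivot s j ≡ 1#
      pivot-≥ s {j} s≤r = ≡.cong (λ b → if b then P j j else 1#) (dec-false (r j ℕ.<? s) (ℕ.≤⇒≯ s≤r))

      stage-step : ∀ s i {j} → r j ≢ s → stage (suc s) i j ≡ stage s i j
      stage-step s i {j} r≢s with ℕ.<-cmp (r j) s
      ... | tri< r<s _ _ = ≡.trans (stage-< (suc s) i (ℕ.m<n⇒m<1+n r<s)) (≡.sym (stage-< s i r<s))
      ... | tri≈ _ r≡s _ = contradiction r≡s r≢s
      ... | tri> _ _ s<r = ≡.trans (stage-≥ (suc s) i s<r) (≡.sym (stage-≥ s i (ℕ.<⇒≤ s<r)))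

      pivot-step : ∀ s {j} → r j ≢ s → pivot (suc s) j ≡ pivot s j
      pivot-step s {j} r≢s with ℕ.<-cmp (r j) s
      ... | tri< r<s _ _ = ≡.trans (pivot-< (suc s) (ℕ.m<n⇒m<1+n r<s)) (≡.sym (pivot-< s r<s))
      ... | tri≈ _ r≡s _ = contradiction r≡s r≢s
      ... | tri> _ _ s<r = ≡.trans (pivot-≥ (suc s) s<r) (≡.sym (pivot-≥ s (ℕ.<⇒≤ s<r)))

      column : ∀ k i → stage (suc (r k)) i k ≈ sum λ l → P l k * stage (r k) i l
      column k i = trans (reflexive (stage-< (suc (r k)) i ℕ.≤-refl)) (sum-cong-≋ term)
        where
        term : ∀ l → A i l * P l k ≈ P l k * stage (r k) i l
        term l with ℕ.<-≤-connex (r l) (r k)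
        ... | inj₁ l<k = trans (*-congˡ (triangular l<k)) (trans (zeroʳ _)
                (sym (trans (*-congʳ (triangular l<k)) (zeroˡ _))))
        ... | inj₂ k≤l = trans (*-comm _ _) (*-congˡ (reflexive (≡.sym (stage-≥ (r k) i k≤l))))

      product-pivot : ∀ k → product (pivot (suc (r k))) ≈ P k k * product (pivot (r k))
      product-pivot k = product-rescale k
        (λ j j≢k → reflexive (pivot-step (r k) (j≢k ∘ r-injective)))
        (reflexive (pivot-< (suc (r k)) ℕ.≤-refl)) (reflexive (pivot-≥ (r k) ℕ.≤-refl))

      det-step : ∀ s → det (stage s) ≈ det A * product (pivot s) →
                 det (stage (suc s)) ≈ det A * product (pivot (suc s))
      det-step s ih with Fin.any? (λ j → r j ℕ.≟ s)
      ... | no none = begin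
        det (stage (suc s))
          ≈⟨ det-cong (λ i j → reflexive (stage-step s i λ r≡s → none (j , r≡s))) ⟩
        det (stage s)
          ≈⟨ ih ⟩
        det A * product (pivot s)
          ≈⟨ *-congˡ (Product.sum-cong-≋ λ j → reflexive (pivot-step s λ r≡s → none (j , r≡s))) ⟨
        det A * product (pivot (suc s)) ∎
      ... | yes (k , ≡.refl) = begin
        det (stage (suc s))
          ≈⟨ det-column k (λ l → P l k) (stage s) (stage (suc s))
               (λ i j j≢k → reflexive (stage-step s i (j≢k ∘ r-injective))) (column k) ⟩
        P k k * det (stage s)
          ≈⟨ *-congˡ ih ⟩
        P k k * (det A * product (pivot s))
          ≈⟨ solve 3 (λ p a d → p ⊕ (a ⊕ d) ⊜ a ⊕ (p ⊕ d)) refl (P k k) (det A) _ ⟩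
        det A * (P k k * product (pivot s))
          ≈⟨ *-congˡ (product-pivot k) ⟨
        det A * product (pivot (suc s)) ∎

      det-stage : ∀ s → det (stage s) ≈ det A * product (pivot s)
      det-stage zero = begin
        det (stage 0)               ≈⟨ det-cong (λ i j → reflexive (stage-≥ 0 i ℕ.z≤n)) ⟩
        det A                       ≈⟨ *-identityʳ _ ⟨
        det A * 1#                  ≈⟨ *-congˡ (product-1 (λ j → reflexive (pivot-≥ 0 {j} ℕ.z≤n))) ⟨
        det A * product (pivot 0)   ∎
      det-stage (suc s) = det-step s (det-stage s)

    -- Any bound b on the ranks serves; it only says when the process stops.
    det-⊗-triangular : ∀ b → (∀ j → r j ℕ.< b) → det (A ⊗ P) ≈ det A * product (λ j → P j j)
    det-⊗-triangular b r<b = begin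
      det (A ⊗ P)                     ≈⟨ det-cong (λ i j → reflexive (stage-< b i (r<b j))) ⟨
      det (stage b)                   ≈⟨ det-stage b ⟩
      det A * product (pivot b)       ≈⟨ *-congˡ (Product.sum-cong-≋ λ j → reflexive (pivot-< b (r<b j))) ⟩
      det A * product (λ j → P j j)   ∎

  -- Lower triangular with ones on the diagonal.
  UnitLower : Matrix n n → Set ℓ
  UnitLower P = (∀ i → P i i ≈ 1#) × (∀ {i j} → i Fin.< j → P i j ≈ 0#)

  -- Upper triangular.
  Upper : Matrix n n → Set ℓ
  Upper T = ∀ {i j} → j Fin.< i → T i j ≈ 0#

  det-unitLower : (P : Matrix n n) → UnitLower P → det P ≈ 1#
  det-unitLower {zero}  P _ = refl
  det-unitLower {suc n} P (unit , lower) = begin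
    det P                              ≈⟨ sum-single (λ j → (- 1#) ^ toℕ j * P zero j * det (minor j P)) zero right ⟩
    1# * P zero zero * det (minor zero P)
      ≈⟨ *-cong (trans (*-identityˡ _) (unit zero))
           (det-unitLower (minor zero P) ((unit ∘ suc) , λ i<j → lower (ℕ.s≤s i<j))) ⟩
    1# * 1#                            ≈⟨ *-identityˡ 1# ⟩
    1#                                 ∎
    where
    right : ∀ j → j ≢ zero → (- 1#) ^ toℕ j * P zero j * det (minor j P) ≈ 0#
    right zero    j≢0 = contradiction ≡.refl j≢0
    right (suc j) _   = trans (*-congʳ (trans (*-congˡ (lower {j = suc j} (ℕ.s≤s ℕ.z≤n))) (zeroʳ _))) (zeroˡ _)

  diagonal-at : (d : Vector Carrier n) (i : Fin n) → diagonal d i i ≈ d i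
  diagonal-at d i with i Fin.≟ i
  ... | yes _  = refl
  ... | no i≢i = contradiction ≡.refl i≢i

  diagonal-⊗ : (d : Vector Carrier n) (A : Matrix n n) → (diagonal d ⊗ A) ≋ (λ i j → d i * A i j)
  diagonal-⊗ {n} d A i j = trans (sum-single (λ l → diagonal d i l * A l j) i off) (*-congʳ (diagonal-at d i))
    where
    off : ∀ l → l ≢ i → diagonal d i l * A l j ≈ 0#
    off l l≢i with i Fin.≟ l
    ... | yes i≡l = contradiction (≡.sym i≡l) l≢i
    ... | no _    = zeroˡ _

  ⊗-diagonal : (A : Matrix n n) (d : Vector Carrier n) → (A ⊗ diagonal d) ≋ (λ i j → A i j * d j)
  ⊗-diagonal {n} A d i j = trans (sum-single (λ l → A i l * diagonal d l j) j off) (*-congˡ (diagonal-at d j))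
    where
    off : ∀ l → l ≢ j → A i l * diagonal d l j ≈ 0#
    off l l≢j with l Fin.≟ j
    ... | yes l≡j = contradiction l≡j l≢j
    ... | no _    = zeroʳ _

  sum-neg : (f : Vector Carrier n) → sum (λ i → - f i) ≈ - sum f
  sum-neg {zero}  f = sym -0#≈0#
  sum-neg {suc n} f = trans (+-congˡ (sum-neg (f ∘ suc))) (⁻¹-∙-comm _ _)

  ⊗-distribʳ-⊖ : (A B : Matrix k m) (C : Matrix m n) → (A ⊖ B) ⊗ C ≋ (A ⊗ C) ⊖ (B ⊗ C)
  ⊗-distribʳ-⊖ {m = m} A B C i j = begin
    sum (λ l → (A i l - B i l) * C l j)
      ≈⟨ sum-cong-≋ {m} (λ l → trans (distribʳ (C l j) (A i l) (- B i l)) (+-congˡ (sym (-‿distribˡ-* (B i l) (C l j))))) ⟩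
    sum (λ l → A i l * C l j - B i l * C l j)
      ≈⟨ ∑-distrib-+ {m} (λ l → A i l * C l j) (λ l → - (B i l * C l j)) ⟩
    (A ⊗ C) i j + sum (λ l → - (B i l * C l j))
      ≈⟨ +-congˡ (sum-neg {m} λ l → B i l * C l j) ⟩
    (A ⊗ C) i j - (B ⊗ C) i j ∎

  ⊗-distribˡ-⊖ : (A B : Matrix m n) (C : Matrix k m) → C ⊗ (A ⊖ B) ≋ (C ⊗ A) ⊖ (C ⊗ B)
  ⊗-distribˡ-⊖ {m = m} A B C i j = begin
    sum (λ l → C i l * (A l j - B l j))
      ≈⟨ sum-cong-≋ {m} (λ l → trans (distribˡ (C i l) (A l j) (- B l j)) (+-congˡ (sym (-‿distribʳ-* (C i l) (B l j))))) ⟩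
    sum (λ l → C i l * A l j - C i l * B l j)
      ≈⟨ ∑-distrib-+ {m} (λ l → C i l * A l j) (λ l → - (C i l * B l j)) ⟩
    (C ⊗ A) i j + sum (λ l → - (C i l * B l j))
      ≈⟨ +-congˡ (sum-neg {m} λ l → C i l * B l j) ⟩
    (C ⊗ A) i j - (C ⊗ B) i j ∎

  -- Right multiplication by P leaves determinants unchanged, and that by T multiplies them
  -- by the product of its diagonal; A ⊗ P ≋ P ⊗ T compares the two.  An upper triangular
  -- matrix is triangular for the reversed ranking.
  det-triangularise : (A P T : Matrix n n) → UnitLower P → Upper T →
    A ⊗ P ≋ P ⊗ T → det A ≈ product (λ i → T i i)
  det-triangularise {n} A P T (unit , lower) upper AP≋PT = begin
    det A                             ≈⟨ *-identityʳ _ ⟨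
    det A * 1#                        ≈⟨ *-congˡ (product-1 unit) ⟨
    det A * product (λ i → P i i)     ≈⟨ det-⊗-triangular toℕ Fin.toℕ-injective A P lower n Fin.toℕ<n ⟨
    det (A ⊗ P)                       ≈⟨ det-cong AP≋PT ⟩
    det (P ⊗ T)                       ≈⟨ det-⊗-triangular (toℕ ∘ Fin.opposite) opposite-injective P T
                                           (λ {i} {j} lt → upper (reverse i j lt)) n (Fin.toℕ<n ∘ Fin.opposite) ⟩
    det P * product (λ i → T i i)     ≈⟨ *-congʳ (det-unitLower P (unit , lower)) ⟩
    1# * product (λ i → T i i)        ≈⟨ *-identityˡ _ ⟩
    product (λ i → T i i)             ∎
    where
    opposite-injective : {i j : Fin n} → toℕ (Fin.opposite i) ≡ toℕ (Fin.opposite j) → i ≡ j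
    opposite-injective {i} {j} eq = ≡.trans (≡.sym (Fin.opposite-involutive i))
      (≡.trans (≡.cong Fin.opposite (Fin.toℕ-injective eq)) (Fin.opposite-involutive j))
    reverse : (i j : Fin n) → Fin.opposite i Fin.< Fin.opposite j → j Fin.< i
    reverse i j lt = ℕ.≰⇒> λ i≤j → ℕ.<⇒≱ lt (≡.subst₂ ℕ._≤_
      (≡.sym (Fin.opposite-prop j)) (≡.sym (Fin.opposite-prop i)) (ℕ.∸-monoʳ-≤ n (ℕ.s≤s i≤j)))

  -- A flag of invariant subspaces, spanned by initial columns of P, determines the
  -- eigenvalues: if A P = P T then (x I - A) P = P (x I - T).
  triangularised⇒eigenvalues : (A P T : Matrix n n) → UnitLower P → Upper T → A ⊗ P ≋ P ⊗ T →
    AreEigenvalues A (λ i → T i i)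
  triangularised⇒eigenvalues {n} A P T P-lower upper AP≋PT x = begin
    det (diagonal (λ _ → x) ⊖ A)
      ≈⟨ det-triangularise _ P (diagonal (λ _ → x) ⊖ T) P-lower upper′ commute ⟩
    product (λ i → (diagonal (λ _ → x) ⊖ T) i i)
      ≈⟨ Product.sum-cong-≋ {n} (λ i → +-congʳ {x = - T i i} (diagonal-at (λ _ → x) i)) ⟩
    product (λ i → x - T i i) ∎
    where
    upper′ : Upper (diagonal (λ _ → x) ⊖ T)
    upper′ {i} {j} j<i with i Fin.≟ j
    ... | yes ≡.refl = contradiction j<i (ℕ.<-irrefl ≡.refl)
    ... | no _       = trans (+-congˡ (trans (-‿cong (upper j<i)) -0#≈0#)) (+-identityˡ 0#)

    commute : (diagonal (λ _ → x) ⊖ A) ⊗ P ≋ P ⊗ (diagonal (λ _ → x) ⊖ T)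
    commute i j = begin
      ((diagonal (λ _ → x) ⊖ A) ⊗ P) i j
        ≈⟨ ⊗-distribʳ-⊖ (diagonal λ _ → x) A P i j ⟩
      (diagonal (λ _ → x) ⊗ P) i j - (A ⊗ P) i j
        ≈⟨ +-cong (trans (diagonal-⊗ (λ _ → x) P i j) (trans (*-comm _ _) (sym (⊗-diagonal P (λ _ → x) i j))))
             (-‿cong (AP≋PT i j)) ⟩
      (P ⊗ diagonal (λ _ → x)) i j - (P ⊗ T) i j
        ≈⟨ ⊗-distribˡ-⊖ (diagonal λ _ → x) T P i j ⟨
      (P ⊗ (diagonal (λ _ → x) ⊖ T)) i j ∎

-- Kronecker products.

-- The encoding of pairs is monotone for the lexicographic order.
remQuot-< : ∀ {m} k {x y : Fin (m ℕ.* k)} → x Fin.< y →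
  let (v , u) = remQuot {m} k x; (v′ , u′) = remQuot {m} k y in
  v Fin.< v′ ⊎ (v ≡ v′ × u Fin.< u′)
remQuot-< {m} k {x} {y} x<y with Fin.<-cmp (quotient {m} k x) (quotient {m} k y)
... | tri< v<v′ _ _ = inj₁ v<v′
... | tri≈ _ v≡v′ _ = inj₂ (v≡v′ , ℕ.+-cancelˡ-< (k ℕ.* toℕ v) (toℕ u) (toℕ u′)
        (≡.subst₂ ℕ._<_ (position x)
          (≡.trans (position y) (≡.cong (λ w → k ℕ.* toℕ w ℕ.+ toℕ u′) (≡.sym v≡v′))) x<y))
  where
  v = quotient {m} k x
  u = remainder {m} k x
  u′ = remainder {m} k y
  position : ∀ z → toℕ z ≡ k ℕ.* toℕ (quotient {m} k z) ℕ.+ toℕ (remainder {m} k z)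
  position z = ≡.trans (≡.cong toℕ (≡.sym (Fin.combine-remQuot {m} k z)))
    (Fin.toℕ-combine (quotient {m} k z) (remainder {m} k z))
... | tri> _ _ v′<v = contradiction x<y (ℕ.<⇒≯ (≡.subst₂ Fin._<_
        (Fin.combine-remQuot {m} k y) (Fin.combine-remQuot {m} k x)
        (Fin.combine-monoˡ-< (remainder {m} k y) (remainder {m} k x) v′<v)))

module Kronecker {c ℓ} (R : CommutativeRing c ℓ) where
  open CommutativeRing R hiding (zero)
  open LinearAlgebra R
  open Determinant R
  open import Algebra.Properties.CommutativeMonoid.Sum +-commutativeMonoid
    using (sum-cong-≋; ∑-distrib-+)
  open import Algebra.Properties.Semiring.Sum semiring using (*-distribˡ-sum; *-distribʳ-sum)
  open import Algebra.Solver.CommutativeMonoid *-commutativeMonoid using (solve; _⊕_; _⊜_)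
  open import Relation.Binary.Reasoning.Setoid setoid

  private variable k l m n m′ n′ k′ : ℕ

  ⊗-cong : {A A′ : Matrix k m} {B B′ : Matrix m n} → A ≋ A′ → B ≋ B′ → A ⊗ B ≋ A′ ⊗ B′
  ⊗-cong {m = m} A≋A′ B≋B′ i j = sum-cong-≋ {m} λ l → *-cong (A≋A′ i l) (B≋B′ l j)

  sum-++ : ∀ m (f : Vector Carrier (m ℕ.+ n)) → sum f ≈ sum (λ i → f (i ↑ˡ n)) + sum (λ j → f (m ↑ʳ j))
  sum-++ zero    f = sym (+-identityˡ _)
  sum-++ (suc m) f = trans (+-congˡ (sum-++ m (f ∘ suc))) (sym (+-assoc _ _ _))

  sum-combine : (f : Vector Carrier (m ℕ.* k)) → sum f ≈ sum λ v → sum λ u → f (combine {m} {k} v u)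
  sum-combine {zero}      f = refl
  sum-combine {suc m} {k} f = trans (sum-++ k f) (+-congˡ (sum-combine {m} {k} λ x → f (k ↑ʳ x)))

  sum-remQuot : (f : Fin m × Fin k → Carrier) →
    sum (λ x → f (remQuot {m} k x)) ≈ sum λ v → sum λ u → f (v , u)
  sum-remQuot {m} {k} f = trans (sum-combine {m} {k} λ x → f (remQuot {m} k x))
    (sum-cong-≋ {m} λ v → sum-cong-≋ {k} λ u → reflexive (≡.cong f (Fin.remQuot-combine v u)))

  sum-*-sum : (f : Vector Carrier m) (g : Vector Carrier n) →
    sum (λ i → sum λ j → f i * g j) ≈ sum f * sum g
  sum-*-sum {m} {n} f g = trans
    (sum-cong-≋ {m} λ i → sym (*-distribˡ-sum {n} (f i) g)) (sym (*-distribʳ-sum {m} (sum g) f))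

  -- The sum of matrices.
  infixl 6 _⊕ᴹ_
  _⊕ᴹ_ : Matrix m n → Matrix m n → Matrix m n
  (A ⊕ᴹ B) i j = A i j + B i j

  ⊗-distribʳ-⊕ : (A B : Matrix k m) (C : Matrix m n) → (A ⊕ᴹ B) ⊗ C ≋ (A ⊗ C) ⊕ᴹ (B ⊗ C)
  ⊗-distribʳ-⊕ {m = m} A B C i j = trans (sum-cong-≋ {m} λ l → distribʳ (C l j) (A i l) (B i l))
    (∑-distrib-+ {m} (λ l → A i l * C l j) (λ l → B i l * C l j))

  ⊗-distribˡ-⊕ : (A B : Matrix m n) (C : Matrix k m) → C ⊗ (A ⊕ᴹ B) ≋ (C ⊗ A) ⊕ᴹ (C ⊗ B)
  ⊗-distribˡ-⊕ {m = m} A B C i j = trans (sum-cong-≋ {m} λ l → distribˡ (C i l) (A l j) (B l j))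
    (∑-distrib-+ {m} (λ l → C i l * A l j) (λ l → C i l * B l j))

  -- The Kronecker product, with rows and columns indexed through remQuot as in the
  -- cartesian product of graphs.
  infixl 7 _⊠_
  _⊠_ : Matrix m n → Matrix k l → Matrix (m ℕ.* k) (n ℕ.* l)
  _⊠_ {m} {n} {k} {l} A B x y =
    A (quotient {m} k x) (quotient {n} l y) *
    B (remainder {m} k x) (remainder {n} l y)

  -- The mixed-product property.
  ⊠-⊗ : (A : Matrix m n) (B : Matrix k l) (C : Matrix n m′) (D : Matrix l k′) →
    (A ⊠ B) ⊗ (C ⊠ D) ≋ (A ⊗ C) ⊠ (B ⊗ D)
  ⊠-⊗ {m} {n} {k} {l} {m′} {k′} A B C D x y = begin
    sum (λ z → (A v (v₁ z) * B u (u₁ z)) * (C (v₁ z) v′ * D (u₁ z) u′))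
      ≈⟨ sum-remQuot {n} {l} (λ (w , t) → (A v w * B u t) * (C w v′ * D t u′)) ⟩
    sum (λ w → sum λ t → (A v w * B u t) * (C w v′ * D t u′))
      ≈⟨ sum-cong-≋ {n} (λ w → sum-cong-≋ {l} λ t →
           solve 4 (λ a b c d → (a ⊕ b) ⊕ (c ⊕ d) ⊜ (a ⊕ c) ⊕ (b ⊕ d)) refl (A v w) (B u t) (C w v′) (D t u′)) ⟩
    sum (λ w → sum λ t → (A v w * C w v′) * (B u t * D t u′))
      ≈⟨ sum-*-sum (λ w → A v w * C w v′) (λ t → B u t * D t u′) ⟩
    ((A ⊗ C) ⊠ (B ⊗ D)) x y ∎
    where
    v = quotient {m} k x
    u = remainder {m} k x
    v′ = quotient {m′} k′ y
    u′ = remainder {m′} k′ y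
    v₁ = λ z → quotient {n} l z
    u₁ = λ z → remainder {n} l z

  ⊠-unitLower : {A : Matrix m m} {B : Matrix k k} → UnitLower A → UnitLower B → UnitLower (A ⊠ B)
  ⊠-unitLower {m} {k} {A} {B} (unitA , lowerA) (unitB , lowerB) =
    (λ x → trans (*-cong (unitA _) (unitB _)) (*-identityˡ 1#)) ,
    λ {x} {y} x<y → [ (λ lt → trans (*-congʳ (lowerA lt)) (zeroˡ _))
                    , (λ (_ , lt) → trans (*-congˡ (lowerB lt)) (zeroʳ _)) ]′ (remQuot-< {m} k x<y)

  ⊠-upper : {A : Matrix m m} {B : Matrix k k} → Upper A → Upper B → Upper (A ⊠ B)
  ⊠-upper {m} {k} {A} {B} upperA upperB y<x =
    [ (λ lt → trans (*-congʳ (upperA lt)) (zeroˡ _))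
    , (λ (_ , lt) → trans (*-congˡ (upperB lt)) (zeroʳ _)) ]′ (remQuot-< {m} k y<x)

open ≡ using (refl; sym; trans; cong; cong₂; subst; subst₂; module ≡-Reasoning)

-- Arithmetic of fractions.

module Rationals where
  open import Data.Rational.Base using (_+_; _*_; _/_)

  -- The inclusion of the integers.
  ι : ℤ.ℤ → ℚ
  ι x = x / 1

  private
    toℚᵘ-/ : ∀ x d .{{_ : ℕ.NonZero d}} → ℚ.toℚᵘ (x / d) ℚᵘ.≃ (x ℚᵘ./ d)
    toℚᵘ-/ x (suc d) = ℚ.toℚᵘ-fromℚᵘ (ℚᵘ.mkℚᵘ x d)

  ι-+ : ∀ x y → ι (x ℤ.+ y) ≡ ι x + ι y
  ι-+ x y = ℚ.toℚᵘ-injective (begin-equality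
    ℚ.toℚᵘ (ι (x ℤ.+ y))              ≃⟨ toℚᵘ-/ _ 1 ⟩
    (x ℤ.+ y) ℚᵘ./ 1                  ≃⟨ ℚᵘ.*≡* (cong (ℤ._* ℤ.1ℤ) (cong₂ ℤ._+_ (sym (ℤ.*-identityʳ x)) (sym (ℤ.*-identityʳ y)))) ⟩
    (x ℚᵘ./ 1) ℚᵘ.+ (y ℚᵘ./ 1)        ≃⟨ ℚᵘ.+-cong (toℚᵘ-/ x 1) (toℚᵘ-/ y 1) ⟨
    ℚ.toℚᵘ (ι x) ℚᵘ.+ ℚ.toℚᵘ (ι y)    ≃⟨ ℚ.toℚᵘ-homo-+ (ι x) (ι y) ⟨
    ℚ.toℚᵘ (ι x + ι y)                ∎)
    where open ℚᵘ.≤-Reasoning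

  ι-* : ∀ x y → ι (x ℤ.* y) ≡ ι x * ι y
  ι-* x y = ℚ.toℚᵘ-injective (begin-equality
    ℚ.toℚᵘ (ι (x ℤ.* y))              ≃⟨ toℚᵘ-/ _ 1 ⟩
    (x ℤ.* y) ℚᵘ./ 1                  ≃⟨ ℚᵘ.≃-refl ⟩
    (x ℚᵘ./ 1) ℚᵘ.* (y ℚᵘ./ 1)        ≃⟨ ℚᵘ.*-cong (toℚᵘ-/ x 1) (toℚᵘ-/ y 1) ⟨
    ℚ.toℚᵘ (ι x) ℚᵘ.* ℚ.toℚᵘ (ι y)    ≃⟨ ℚ.toℚᵘ-homo-* (ι x) (ι y) ⟨
    ℚ.toℚᵘ (ι x * ι y)                ∎)
    where open ℚᵘ.≤-Reasoning

  /-*-cancel : ∀ x d .{{_ : ℕ.NonZero d}} → (x / d) * ι (ℤ.+ d) ≡ ι x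
  /-*-cancel x d@(suc _) = ℚ.toℚᵘ-injective (begin-equality
    ℚ.toℚᵘ ((x / d) * ι (ℤ.+ d))              ≃⟨ ℚ.toℚᵘ-homo-* (x / d) (ι (ℤ.+ d)) ⟩
    ℚ.toℚᵘ (x / d) ℚᵘ.* ℚ.toℚᵘ (ι (ℤ.+ d))    ≃⟨ ℚᵘ.*-cong (toℚᵘ-/ x d) (toℚᵘ-/ (ℤ.+ d) 1) ⟩
    (x ℚᵘ./ d) ℚᵘ.* ((ℤ.+ d) ℚᵘ./ 1)          ≃⟨ ℚᵘ.*≡* (trans (ℤ.*-identityʳ (x ℤ.* ℤ.+ d))
                                                   (cong (λ e → x ℤ.* ℤ.+ e) (sym (ℕ.*-identityʳ d)))) ⟩
    x ℚᵘ./ 1                                  ≃⟨ toℚᵘ-/ x 1 ⟨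
    ℚ.toℚᵘ (ι x)                              ∎)
    where open ℚᵘ.≤-Reasoning

  -- The inclusion of the naturals.
  fromℕ : ℕ → ℚ
  fromℕ m = ι (ℤ.+ m)

  fromℕ-suc : ∀ m → fromℕ (suc m) ≡ 1ℚ + fromℕ m
  fromℕ-suc m = ι-+ (ℤ.+ 1) (ℤ.+ m)

open Rationals

-- Rational matrices of complete graphs and of their products.

module RationalMatrix where
  open import Data.Rational.Base using (_+_; _*_; _-_)
  open LinearAlgebra ℚ.+-*-commutativeRing public
  open Determinant ℚ.+-*-commutativeRing public
  open Kronecker ℚ.+-*-commutativeRing public
  open CommutativeRing ℚ.+-*-commutativeRing using (+-commutativeMonoid)
  open import Algebra.Properties.CommutativeMonoid.Sum +-commutativeMonoid public
    using (sum-cong-≋; ∑-distrib-+)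
  open +-*-Solver using (solve; _:+_; _:*_; _:-_; _:=_; con)
  open ≡-Reasoning

  private variable k m n : ℕ

  -- The indicator of a truth value.
  bit : Bool → ℚ
  bit b = if b then 1ℚ else 0ℚ

  -- The identity matrix, as the Kronecker delta.
  δ : Matrix m m
  δ i j = bit (does (i Fin.≟ j))

  δ-sym : (i j : Fin m) → δ i j ≡ δ j i
  δ-sym i j with i Fin.≟ j | j Fin.≟ i
  ... | yes _    | yes _    = refl
  ... | no _     | no _     = refl
  ... | yes refl | no i≢i   = contradiction refl i≢i
  ... | no j≢j   | yes refl = contradiction refl j≢j

  δ-diagonal : (i : Fin m) → δ i i ≡ 1ℚ
  δ-diagonal i with i Fin.≟ i
  ... | yes _  = refl
  ... | no i≢i = contradiction refl i≢i

  sum-δ : (i : Fin m) (f : Vector ℚ m) → sum (λ l → δ i l * f l) ≡ f i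
  sum-δ {m} i f = trans (diagonal-⊗ (λ _ → 1ℚ) (λ l _ → f l) i i) (ℚ.*-identityˡ (f i))

  sum-const : ∀ m x → sum {m} (λ _ → x) ≡ fromℕ m * x
  sum-const zero    x = sym (ℚ.*-zeroˡ x)
  sum-const (suc m) x = begin
    x + sum {m} (λ _ → x)    ≡⟨ cong (x +_) (sum-const m x) ⟩
    x + fromℕ m * x          ≡⟨ solve 2 (λ x m → x :+ m :* x := (con 1ℚ :+ m) :* x) refl x (fromℕ m) ⟩
    (1ℚ + fromℕ m) * x       ≡⟨ cong (_* x) (fromℕ-suc m) ⟨
    fromℕ (suc m) * x        ∎

  -- The eigenvalue on the constant vectors, then that on the vectors of sum zero.
  Spectrum : Set
  Spectrum = Vector ℚ 2

  -- The m by m matrix with this spectrum, α₀ J/m + α₁ (I - J/m) for J the matrix of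
  -- ones.  The number i stands for 1/m; lemmas that need this assume m i = 1.
  completeForm : ℚ → Spectrum → Matrix m m
  completeForm i α v w = α zero * i + α (suc zero) * (δ v w - i)

  completeForm-sym : ∀ i α (v w : Fin m) → completeForm i α v w ≡ completeForm i α w v
  completeForm-sym i α v w = cong (λ d → α zero * i + α (suc zero) * (d - i)) (δ-sym v w)

  -- J/m and I - J/m are orthogonal projections, so the eigenvalues multiply.
  completeForm-⊗ : ∀ {i} → fromℕ m * i ≡ 1ℚ → ∀ α β →
    completeForm {m} i α ⊗ completeForm i β ≋ completeForm i (λ a → α a * β a)
  completeForm-⊗ {m} {i} mi α β v w = begin
    sum (λ l → completeForm i α v l * completeForm i β l w)
      ≡⟨ sum-cong-≋ {m} (λ l → solve 7 (λ a₀ a₁ b₀ b₁ i x y →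
           (a₀ :* i :+ a₁ :* (x :- i)) :* (b₀ :* i :+ b₁ :* (y :- i)) :=
           x :* (a₁ :* (b₀ :* i :+ b₁ :* (y :- i))) :+
           (y :* ((a₀ :- a₁) :* i :* b₁) :+ (a₀ :- a₁) :* i :* ((b₀ :- b₁) :* i)))
           refl a₀ a₁ b₀ b₁ i (δ v l) (δ l w)) ⟩
    sum (λ l → δ v l * f l + (δ l w * c + d))
      ≡⟨ ∑-distrib-+ {m} (λ l → δ v l * f l) (λ l → δ l w * c + d) ⟩
    sum (λ l → δ v l * f l) + sum (λ l → δ l w * c + d)
      ≡⟨ cong₂ _+_ (sum-δ v f) (trans (∑-distrib-+ {m} (λ l → δ l w * c) (λ _ → d)) (cong₂ _+_
           (trans (sum-cong-≋ {m} λ l → cong (_* c) (δ-sym l w)) (sum-δ w (λ _ → c)))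
           (sum-const m d))) ⟩
    f v + (c + fromℕ m * d)
      ≡⟨ solve 7 (λ a₀ a₁ b₀ b₁ i x N →
           a₁ :* (b₀ :* i :+ b₁ :* (x :- i)) :+ ((a₀ :- a₁) :* i :* b₁ :+ N :* ((a₀ :- a₁) :* i :* ((b₀ :- b₁) :* i))) :=
           a₀ :* b₀ :* i :+ a₁ :* b₁ :* (x :- i) :+ (N :* i :- con 1ℚ) :* ((a₀ :- a₁) :* ((b₀ :- b₁) :* i)))
           refl a₀ a₁ b₀ b₁ i (δ v w) (fromℕ m) ⟩
    a₀ * b₀ * i + a₁ * b₁ * (δ v w - i) + (fromℕ m * i - 1ℚ) * e
      ≡⟨ cong (λ t → a₀ * b₀ * i + a₁ * b₁ * (δ v w - i) + (t - 1ℚ) * e) mi ⟩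
    a₀ * b₀ * i + a₁ * b₁ * (δ v w - i) + (1ℚ - 1ℚ) * e
      ≡⟨ trans (cong (a₀ * b₀ * i + a₁ * b₁ * (δ v w - i) +_) (ℚ.*-zeroˡ e)) (ℚ.+-identityʳ _) ⟩
    completeForm i (λ a → α a * β a) v w ∎
    where
    a₀ = α zero
    a₁ = α (suc zero)
    b₀ = β zero
    b₁ = β (suc zero)
    c = (a₀ - a₁) * i * b₁
    d = (a₀ - a₁) * i * ((b₀ - b₁) * i)
    e = (a₀ - a₁) * ((b₀ - b₁) * i)
    f = λ l → a₁ * completeForm i β l w

  -- The basis e₀ + ... + eₘ, e₁, ..., eₘ, as columns.  The span of the first column and
  -- any further ones is invariant under every completeForm.
  flag : Matrix (suc m) (suc m)
  flag v zero    = 1ℚ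
  flag v (suc w) = δ v (suc w)

  -- The matrix of completeForm i α in the basis flag.
  triangle : ℚ → Spectrum → Matrix (suc m) (suc m)
  triangle i α zero    zero    = α zero
  triangle i α zero    (suc w) = (α zero - α (suc zero)) * i
  triangle i α (suc v) zero    = 0ℚ
  triangle i α (suc v) (suc w) = α (suc zero) * δ v w

  flag-unitLower : UnitLower (flag {m})
  flag-unitLower = unit , lower
    where
    unit : ∀ i → flag i i ≡ 1ℚ
    unit zero    = refl
    unit (suc i) = δ-diagonal (suc i)
    lower : ∀ {i j} → i Fin.< j → flag i j ≡ 0ℚ
    lower {i} {suc j} i<j with i Fin.≟ suc j
    ... | yes refl = contradiction i<j (ℕ.<-irrefl refl)
    ... | no _     = refl

  triangle-upper : ∀ i α → Upper (triangle {m} i α)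
  triangle-upper i α {suc v} {zero}  _ = refl
  triangle-upper i α {suc v} {suc w} w<v with v Fin.≟ w
  ... | yes refl = contradiction w<v (ℕ.<-irrefl refl)
  ... | no _     = ℚ.*-zeroʳ (α (suc zero))

  -- Which entry of a spectrum occurs at a given diagonal place of triangle: the constant
  -- vector comes first, all other places carry the other eigenvalue.
  class : Fin (suc m) → Fin 2
  class zero    = zero
  class (suc _) = suc zero

  triangle-diagonal : ∀ i α (v : Fin (suc m)) → triangle i α v v ≡ α (class v)
  triangle-diagonal i α zero    = refl
  triangle-diagonal i α (suc v) = trans (cong (α (suc zero) *_) (δ-diagonal v)) (ℚ.*-identityʳ (α (suc zero)))

  -- The constant vectors are eigenvectors for α₀.
  completeForm-row : ∀ {i} → fromℕ m * i ≡ 1ℚ → ∀ α (v : Fin m) → sum (completeForm i α v) ≡ α zero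
  completeForm-row {m} {i} mi α v = begin
    sum (completeForm i α v)
      ≡⟨ sum-cong-≋ {m} (λ w → solve 4 (λ a₀ a₁ i x →
           a₀ :* i :+ a₁ :* (x :- i) := x :* a₁ :+ (a₀ :- a₁) :* i) refl a₀ a₁ i (δ v w)) ⟩
    sum (λ w → δ v w * a₁ + (a₀ - a₁) * i)
      ≡⟨ trans (∑-distrib-+ {m} (λ w → δ v w * a₁) (λ _ → (a₀ - a₁) * i))
           (cong₂ _+_ (sum-δ v (λ _ → a₁)) (sum-const m ((a₀ - a₁) * i))) ⟩
    a₁ + fromℕ m * ((a₀ - a₁) * i)
      ≡⟨ solve 4 (λ a₀ a₁ N i → a₁ :+ N :* ((a₀ :- a₁) :* i) := a₁ :+ (a₀ :- a₁) :* (N :* i))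
           refl a₀ a₁ (fromℕ m) i ⟩
    a₁ + (a₀ - a₁) * (fromℕ m * i)
      ≡⟨ cong (λ t → a₁ + (a₀ - a₁) * t) mi ⟩
    a₁ + (a₀ - a₁) * 1ℚ
      ≡⟨ solve 2 (λ a₀ a₁ → a₁ :+ (a₀ :- a₁) :* con 1ℚ := a₀) refl a₀ a₁ ⟩
    a₀ ∎
    where
    a₀ = α zero
    a₁ = α (suc zero)

  completeForm-flag : ∀ {i} → fromℕ (suc m) * i ≡ 1ℚ → ∀ α →
    completeForm {suc m} i α ⊗ flag ≋ flag ⊗ triangle i α
  completeForm-flag {m} {i} mi α v zero = begin
    sum (λ l → completeForm i α v l * 1ℚ)
      ≡⟨ sum-cong-≋ {suc m} (λ l → ℚ.*-identityʳ (completeForm i α v l)) ⟩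
    sum (completeForm i α v)
      ≡⟨ completeForm-row mi α v ⟩
    α zero
      ≡⟨ solve 1 (λ a → a := con 1ℚ :* a :+ con 0ℚ) refl (α zero) ⟩
    1ℚ * α zero + 0ℚ
      ≡⟨ cong (1ℚ * α zero +_) (sum-zero {m} _ λ l → ℚ.*-zeroʳ (δ v (suc l))) ⟨
    (flag ⊗ triangle i α) v zero ∎
  completeForm-flag {m} {i} mi α v (suc w) = begin
    sum (λ l → completeForm i α v l * δ l (suc w))
      ≡⟨ ⊗-diagonal (completeForm i α) (λ _ → 1ℚ) v (suc w) ⟩
    completeForm i α v (suc w) * 1ℚ
      ≡⟨ solve 4 (λ a₀ a₁ i x → (a₀ :* i :+ a₁ :* (x :- i)) :* con 1ℚ :=
           con 1ℚ :* ((a₀ :- a₁) :* i) :+ x :* a₁) refl (α zero) (α (suc zero)) i (δ v (suc w)) ⟩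
    1ℚ * ((α zero - α (suc zero)) * i) + δ v (suc w) * α (suc zero)
      ≡⟨ cong (1ℚ * ((α zero - α (suc zero)) * i) +_) (begin
           δ v (suc w) * α (suc zero)
             ≡⟨ ⊗-diagonal {m} (λ _ l → δ v (suc l)) (λ _ → α (suc zero)) w w ⟨
           sum (λ l → δ v (suc l) * diagonal (λ _ → α (suc zero)) l w)
             ≡⟨ sum-cong-≋ {m} (λ l → cong (δ v (suc l) *_) (scale (does (l Fin.≟ w)))) ⟩
           sum (λ l → δ v (suc l) * (α (suc zero) * δ l w)) ∎) ⟩
    (flag ⊗ triangle i α) v (suc w) ∎
    where
    scale : ∀ b → (if b then α (suc zero) else 0ℚ) ≡ α (suc zero) * bit b
    scale true  = sym (ℚ.*-identityʳ _)
    scale false = sym (ℚ.*-zeroʳ (α (suc zero)))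

  -- Eigenvalues on the four tensor products of a space of constant or sum-zero vectors on
  -- the first factor with one on the second.
  GridSpectrum : Set
  GridSpectrum = Fin 2 → Spectrum

  -- The matrix with eigenvalues γ a b on the index set Fin m × Fin k, where i and h stand
  -- for 1/m and 1/k.  The spectrum δ a is that of the projection onto the constants for
  -- a = 0 and onto the vectors of sum zero for a = 1.
  gridForm : ℚ → ℚ → GridSpectrum → Matrix (m ℕ.* k) (m ℕ.* k)
  gridForm {m} {k} i h γ =
    completeForm {m} i (δ zero) ⊠ completeForm {k} h (γ zero) ⊕ᴹ
    completeForm {m} i (δ (suc zero)) ⊠ completeForm {k} h (γ (suc zero))

  gridForm-cong : ∀ {i h} {γ γ′ : GridSpectrum} → (∀ a b → γ a b ≡ γ′ a b) →
    gridForm {m} {k} i h γ ≋ gridForm {m} {k} i h γ′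
  gridForm-cong {m} {k} {i} {h} {γ} {γ′} γ≡γ′ x y = cong₂ _+_
    (cong (completeForm {m} i (δ zero) (quotient {m} k x) (quotient {m} k y) *_) (form zero))
    (cong (completeForm {m} i (δ (suc zero)) (quotient {m} k x) (quotient {m} k y) *_) (form (suc zero)))
    where
    u u′ : Fin k
    u  = remainder {m} k x
    u′ = remainder {m} k y
    form : ∀ a → completeForm h (γ a) u u′ ≡ completeForm h (γ′ a) u u′
    form a = cong₂ (λ α₀ α₁ → α₀ * h + α₁ * (δ u u′ - h)) (γ≡γ′ a zero) (γ≡γ′ a (suc zero))

  gridForm-sym : ∀ i h γ x y → gridForm {m} {k} i h γ x y ≡ gridForm {m} {k} i h γ y x
  gridForm-sym {m} {k} i h γ x y = cong₂ _+_ (swap zero) (swap (suc zero))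
    where
    swap : ∀ a → (completeForm {m} i (δ a) ⊠ completeForm {k} h (γ a)) x y ≡
                 (completeForm {m} i (δ a) ⊠ completeForm {k} h (γ a)) y x
    swap a = cong₂ _*_
      (completeForm-sym i (δ a) (quotient {m} k x) (quotient {m} k y))
      (completeForm-sym h (γ a) (remainder {m} k x) (remainder {m} k y))

  -- Products of distinct projections vanish, so the eigenvalues multiply.
  gridForm-⊗ : ∀ {i h} → fromℕ m * i ≡ 1ℚ → fromℕ k * h ≡ 1ℚ → ∀ γ γ′ →
    gridForm {m} {k} i h γ ⊗ gridForm {m} {k} i h γ′ ≋ gridForm {m} {k} i h (λ a b → γ a b * γ′ a b)
  gridForm-⊗ {m} {k} {i} {h} mi kh γ γ′ x y = begin
    ((S zero ⊕ᴹ S (suc zero)) ⊗ (S′ zero ⊕ᴹ S′ (suc zero))) x y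
      ≡⟨ ⊗-distribʳ-⊕ (S zero) (S (suc zero)) (S′ zero ⊕ᴹ S′ (suc zero)) x y ⟩
    (S zero ⊗ (S′ zero ⊕ᴹ S′ (suc zero))) x y + (S (suc zero) ⊗ (S′ zero ⊕ᴹ S′ (suc zero))) x y
      ≡⟨ cong₂ _+_ (⊗-distribˡ-⊕ (S′ zero) (S′ (suc zero)) (S zero) x y)
                   (⊗-distribˡ-⊕ (S′ zero) (S′ (suc zero)) (S (suc zero)) x y) ⟩
    ((S zero ⊗ S′ zero) x y + (S zero ⊗ S′ (suc zero)) x y) +
    ((S (suc zero) ⊗ S′ zero) x y + (S (suc zero) ⊗ S′ (suc zero)) x y)
      ≡⟨ cong₂ _+_ (cong₂ _+_ (summand zero zero) (summand zero (suc zero)))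
                   (cong₂ _+_ (summand (suc zero) zero) (summand (suc zero) (suc zero))) ⟩
    (E zero zero * B zero zero + E zero (suc zero) * B zero (suc zero)) +
    (E (suc zero) zero * B (suc zero) zero + E (suc zero) (suc zero) * B (suc zero) (suc zero))
      ≡⟨ solve 6 (λ i x p q r s →
           ((con 1ℚ :* i :+ con 0ℚ :* (x :- i)) :* p :+ (con 0ℚ :* i :+ con 0ℚ :* (x :- i)) :* q) :+
           ((con 0ℚ :* i :+ con 0ℚ :* (x :- i)) :* r :+ (con 0ℚ :* i :+ con 1ℚ :* (x :- i)) :* s) :=
           (con 1ℚ :* i :+ con 0ℚ :* (x :- i)) :* p :+ (con 0ℚ :* i :+ con 1ℚ :* (x :- i)) :* s)
           refl i (δ v v′) (B zero zero) (B zero (suc zero)) (B (suc zero) zero) (B (suc zero) (suc zero)) ⟩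
    gridForm {m} {k} i h (λ a b → γ a b * γ′ a b) x y ∎
    where
    S S′ : Fin 2 → Matrix (m ℕ.* k) (m ℕ.* k)
    S  a = completeForm {m} i (δ a) ⊠ completeForm {k} h (γ a)
    S′ a = completeForm {m} i (δ a) ⊠ completeForm {k} h (γ′ a)
    v v′ : Fin m
    v  = quotient {m} k x
    v′ = quotient {m} k y
    u u′ : Fin k
    u  = remainder {m} k x
    u′ = remainder {m} k y
    E B : Fin 2 → Fin 2 → ℚ
    E a b = completeForm {m} i (λ c → δ a c * δ b c) v v′
    B a b = completeForm {k} h (λ c → γ a c * γ′ b c) u u′
    summand : ∀ a b → (S a ⊗ S′ b) x y ≡ E a b * B a b
    summand a b = trans
      (⊠-⊗ (completeForm {m} i (δ a)) (completeForm {k} h (γ a)) (completeForm {m} i (δ b)) (completeForm {k} h (γ′ b)) x y)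
      (cong₂ _*_ (completeForm-⊗ {m} mi (δ a) (δ b) v v′) (completeForm-⊗ {k} kh (γ a) (γ′ b) u u′))

  -- Tensor products of the two bases, in lexicographic order.
  gridFlag : Matrix (suc m ℕ.* suc k) (suc m ℕ.* suc k)
  gridFlag {m} {k} = flag {m} ⊠ flag {k}

  -- The matrix of gridForm i h γ in the basis gridFlag.
  gridTriangle : ℚ → ℚ → GridSpectrum → Matrix (suc m ℕ.* suc k) (suc m ℕ.* suc k)
  gridTriangle {m} {k} i h γ =
    triangle {m} i (δ zero) ⊠ triangle {k} h (γ zero) ⊕ᴹ
    triangle {m} i (δ (suc zero)) ⊠ triangle {k} h (γ (suc zero))

  gridFlag-unitLower : UnitLower (gridFlag {m} {k})
  gridFlag-unitLower {m} {k} = ⊠-unitLower (flag-unitLower {m}) (flag-unitLower {k})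

  gridTriangle-upper : ∀ i h γ → Upper (gridTriangle {m} {k} i h γ)
  gridTriangle-upper {m} {k} i h γ {x} {y} y<x = cong₂ _+_ (upper zero) (upper (suc zero))
    where
    upper : ∀ a → (triangle {m} i (δ a) ⊠ triangle {k} h (γ a)) x y ≡ 0ℚ
    upper a = ⊠-upper {A = triangle {m} i (δ a)} {B = triangle {k} h (γ a)}
      (triangle-upper {m} i (δ a)) (triangle-upper {k} h (γ a)) {x} {y} y<x

  gridTriangle-diagonal : ∀ i h γ (x : Fin (suc m ℕ.* suc k)) →
    let (v , u) = remQuot {suc m} (suc k) x in
    gridTriangle {m} {k} i h γ x x ≡ γ (class v) (class u)
  gridTriangle-diagonal {m} {k} i h γ x = begin
    gridTriangle {m} {k} i h γ x x
      ≡⟨ cong₂ _+_ (cong₂ _*_ (triangle-diagonal i (δ zero) v) (triangle-diagonal h (γ zero) u))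
                   (cong₂ _*_ (triangle-diagonal i (δ (suc zero)) v) (triangle-diagonal h (γ (suc zero)) u)) ⟩
    δ zero (class v) * γ zero (class u) + δ (suc zero) (class v) * γ (suc zero) (class u)
      ≡⟨ select (class v) ⟩
    γ (class v) (class u) ∎
    where
    v = quotient {suc m} (suc k) x
    u = remainder {suc m} (suc k) x
    select : ∀ a → δ zero a * γ zero (class u) + δ (suc zero) a * γ (suc zero) (class u) ≡ γ a (class u)
    select zero = solve 2 (λ p q → con 1ℚ :* p :+ con 0ℚ :* q := p) refl (γ zero (class u)) (γ (suc zero) (class u))
    select (suc zero) = solve 2 (λ p q → con 0ℚ :* p :+ con 1ℚ :* q := q) refl (γ zero (class u)) (γ (suc zero) (class u))

  gridForm-flag : ∀ {i h} → fromℕ (suc m) * i ≡ 1ℚ → fromℕ (suc k) * h ≡ 1ℚ → ∀ γ →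
    gridForm {suc m} {suc k} i h γ ⊗ gridFlag {m} {k} ≋ gridFlag {m} {k} ⊗ gridTriangle {m} {k} i h γ
  gridForm-flag {m} {k} {i} {h} mi kh γ x y = begin
    ((S zero ⊕ᴹ S (suc zero)) ⊗ F) x y
      ≡⟨ ⊗-distribʳ-⊕ (S zero) (S (suc zero)) F x y ⟩
    (S zero ⊗ F) x y + (S (suc zero) ⊗ F) x y
      ≡⟨ cong₂ _+_ (summand zero) (summand (suc zero)) ⟩
    (F ⊗ T zero) x y + (F ⊗ T (suc zero)) x y
      ≡⟨ ⊗-distribˡ-⊕ (T zero) (T (suc zero)) F x y ⟨
    (F ⊗ (T zero ⊕ᴹ T (suc zero))) x y ∎
    where
    F = gridFlag {m} {k}
    v v′ : Fin (suc m)
    v  = quotient {suc m} (suc k) x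
    v′ = quotient {suc m} (suc k) y
    u u′ : Fin (suc k)
    u  = remainder {suc m} (suc k) x
    u′ = remainder {suc m} (suc k) y
    S T : Fin 2 → Matrix (suc m ℕ.* suc k) (suc m ℕ.* suc k)
    S a = completeForm {suc m} i (δ a) ⊠ completeForm {suc k} h (γ a)
    T a = triangle {m} i (δ a) ⊠ triangle {k} h (γ a)
    summand : ∀ a → (S a ⊗ F) x y ≡ (F ⊗ T a) x y
    summand a = begin
      (S a ⊗ F) x y
        ≡⟨ ⊠-⊗ (completeForm {suc m} i (δ a)) (completeForm {suc k} h (γ a)) (flag {m}) (flag {k}) x y ⟩
      ((completeForm {suc m} i (δ a) ⊗ flag) ⊠ (completeForm {suc k} h (γ a) ⊗ flag)) x y
        ≡⟨ cong₂ _*_ (completeForm-flag {m} mi (δ a) v v′) (completeForm-flag {k} kh (γ a) u u′) ⟩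
      ((flag ⊗ triangle {m} i (δ a)) ⊠ (flag ⊗ triangle {k} h (γ a))) x y
        ≡⟨ ⊠-⊗ (flag {m}) (flag {k}) (triangle {m} i (δ a)) (triangle {k} h (γ a)) x y ⟨
      (F ⊗ T a) x y ∎

module RM = RationalMatrix
open RationalMatrix using (bit; δ)

open import Defs

-- Connectedness and degrees in the cartesian product.

K-connected : ∀ n → Connected (K n)
K-connected n i j with i Fin.≟ j
... | yes refl = ε
... | no i≢j   = i≢j ◅ ε

□-connected : ∀ {m k} (G : Graph m) (H : Graph k) → Connected G → Connected H → Connected (G □ H)
□-connected {m} {k} G H G-connected H-connected x y =
  subst₂ (Star _~_) (Fin.combine-remQuot {m} k x) (Fin.combine-remQuot {m} k y)
    (gmap (λ w → combine w u) stepˡ (G-connected v v′) ◅◅ gmap (combine v′) stepʳ (H-connected u u′))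
  where
  open Graph (G □ H) using (_~_)
  v  = quotient {m} k x
  v′ = quotient {m} k y
  u  = remainder {m} k x
  u′ = remainder {m} k y
  quotient-combine : ∀ w t → quotient {m} k (combine w t) ≡ w
  quotient-combine w t = cong proj₁ (Fin.remQuot-combine w t)
  remainder-combine : ∀ w t → remainder {m} k (combine w t) ≡ t
  remainder-combine w t = cong proj₂ (Fin.remQuot-combine {m} w t)
  stepˡ : ∀ {w w′} → Graph._~_ G w w′ → combine w u ~ combine w′ u
  stepˡ {w} {w′} w~w′ = inj₂
    ( trans (remainder-combine w u) (sym (remainder-combine w′ u))
    , subst₂ (Graph._~_ G) (sym (quotient-combine w u)) (sym (quotient-combine w′ u)) w~w′ )
  stepʳ : ∀ {t t′} → Graph._~_ H t t′ → combine v′ t ~ combine v′ t′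
  stepʳ {t} {t′} t~t′ = inj₁
    ( trans (quotient-combine v′ t) (sym (quotient-combine v′ t′))
    , subst₂ (Graph._~_ H) (sym (remainder-combine v′ t)) (sym (remainder-combine v′ t′)) t~t′ )

-- Two encoded pairs are equal exactly when both components are.
≟-remQuot : ∀ {m} k (x y : Fin (m ℕ.* k)) → does (x Fin.≟ y) ≡
  does (quotient {m} k x Fin.≟ quotient {m} k y) ∧ does (remainder {m} k x Fin.≟ remainder {m} k y)
≟-remQuot {m} k x y with quotient {m} k x Fin.≟ quotient {m} k y | remainder {m} k x Fin.≟ remainder {m} k y
... | no v≢v′  | _        = dec-false (x Fin.≟ y) (v≢v′ ∘ cong (quotient {m} k))
... | yes _    | no u≢u′  = dec-false (x Fin.≟ y) (u≢u′ ∘ cong (remainder {m} k))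
... | yes v≡v′ | yes u≡u′ = dec-true (x Fin.≟ y) (trans (sym (Fin.combine-remQuot {m} k x))
        (trans (cong₂ combine v≡v′ u≡u′) (Fin.combine-remQuot {m} k y)))

-- Counting by filtering agrees with summing indicators.
fromℕ-length-filter : ∀ {a p} {A : Set a} {P : Pred A p} (P? : Decidable P) {n} (f : Fin n → A) →
  fromℕ (length (filter P? (tabulate f))) ≡ RM.sum (λ i → bit (does (P? (f i))))
fromℕ-length-filter P? {zero}  f = refl
fromℕ-length-filter P? {suc n} f with does (P? (f zero))
... | true  = trans (fromℕ-suc (length (filter P? (tabulate (f ∘ suc))))) (cong (1ℚ ℚ.+_) (fromℕ-length-filter P? (f ∘ suc)))
... | false = trans (fromℕ-length-filter P? (f ∘ suc)) (sym (ℚ.+-identityˡ _))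

-- Adjacency in a cartesian product of two complete graphs, where p and q tell whether the
-- first and the second coordinates agree: exactly one of them does.
adjacent : Bool → Bool → Bool
adjacent p q = (p ∧ not q) ∨ (q ∧ not p)

-- For each vertex w of K n, exactly one of the two vertices over w is a neighbour of x.
degree-prism : ∀ n x → fromℕ (degree (K n □ K 2) x) ≡ fromℕ n
degree-prism n x = begin
  fromℕ (degree (K n □ K 2) x)
    ≡⟨ fromℕ-length-filter (Graph._~?_ (K n □ K 2) x) (λ y → y) ⟩
  RM.sum (λ y → bit (adjacent (does (v Fin.≟ quotient {n} 2 y)) (does (u Fin.≟ remainder {n} 2 y))))
    ≡⟨ RM.sum-remQuot {n} {2} (λ (w , t) → bit (adjacent (does (v Fin.≟ w)) (does (u Fin.≟ t)))) ⟩
  RM.sum (λ w → RM.sum λ t → bit (adjacent (does (v Fin.≟ w)) (does (u Fin.≟ t))))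
    ≡⟨ RM.sum-cong-≋ {n} (λ w → one u (does (v Fin.≟ w))) ⟩
  RM.sum {n} (λ _ → 1ℚ)
    ≡⟨ trans (RM.sum-const n 1ℚ) (ℚ.*-identityʳ (fromℕ n)) ⟩
  fromℕ n ∎
  where
  open ≡-Reasoning
  v = quotient {n} 2 x
  u = remainder {n} 2 x
  one : ∀ (u : Fin 2) p → RM.sum {2} (λ t → bit (adjacent p (does (u Fin.≟ t)))) ≡ 1ℚ
  one zero       true  = refl
  one zero       false = refl
  one (suc zero) true  = refl
  one (suc zero) false = refl

-- Real matrices through their rational approximations.

-- The rational matrix of t-th approximations.  All the operations on reals act termwise,
-- so identities of matrices can be checked at each t.
_at_ : ∀ {m n} → Matrix m n → ℕ → RM.Matrix m n
(A at t) i j = seq (A i j) t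

-- A rational matrix as a real one.
lift : ∀ {m n} → RM.Matrix m n → Matrix m n
lift A i j = fromℚ (A i j)

seq-sum : ∀ {n} (f : Vector ℝ n) t → seq (sum f) t ≡ RM.sum (λ i → seq (f i) t)
seq-sum {zero}  f t = refl
seq-sum {suc n} f t = cong (seq (f zero) t ℚ.+_) (seq-sum (f ∘ suc) t)

at-⊗ : ∀ {k m n} (A : Matrix k m) (B : Matrix m n) t → (A ⊗ B) at t RM.≋ (A at t) RM.⊗ (B at t)
at-⊗ A B t i j = seq-sum (λ l → A i l *ᴿ B l j) t

seq-if : ∀ b x y t → seq (if b then fromℚ x else fromℚ y) t ≡ (if b then x else y)
seq-if true  x y t = refl
seq-if false x y t = refl

laplacian-at : ∀ {m} (G : Graph m) t x y → seq (laplacian G x y) t ≡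
  (if does (x Fin.≟ y) then fromℕ (degree G x) else 0ℚ) ℚ.- bit (does (Graph._~?_ G x y))
laplacian-at G t x y = cong₂ ℚ._-_
  (seq-if (does (x Fin.≟ y)) _ _ t) (seq-if (does (Graph._~?_ G x y)) _ _ t)

2ℚ : ℚ
2ℚ = fromℕ 2

-- The eigenvalues on (constant, constant), (constant, sum-zero), (sum-zero, constant)
-- and (sum-zero, sum-zero).
grid : ℚ → ℚ → ℚ → ℚ → RM.GridSpectrum
grid a b c d zero    zero    = a
grid a b c d zero    (suc _) = b
grid a b c d (suc _) zero    = c
grid a b c d (suc _) (suc _) = d

-- In the following spectra and identities N, i and j stand for n, 1/n and 1/(n + 2).

laplacianSpectrum : ℚ → RM.GridSpectrum
laplacianSpectrum N = grid 0ℚ 2ℚ N (N ℚ.+ 2ℚ)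

pseudoinverseSpectrum : ℚ → ℚ → RM.GridSpectrum
pseudoinverseSpectrum i j = grid 0ℚ ½ i j

-- As all diagonal entries of the pseudoinverse L† are equal, say to c, the resistance
-- matrix is 2c J - 2 L†.  It agrees with -2 L† on the vectors of sum zero, and its
-- eigenvalue on the constants is 2c times the number 2n of vertices, that is, twice the
-- trace of L†.
resistanceSpectrum : ℚ → ℚ → ℚ → RM.GridSpectrum
resistanceSpectrum N i j =
  grid (2ℚ ℚ.* (½ ℚ.+ (N ℚ.- 1ℚ) ℚ.* (i ℚ.+ j))) (ℚ.- (2ℚ ℚ.* ½)) (ℚ.- (2ℚ ℚ.* i)) (ℚ.- (2ℚ ℚ.* j))

-- The entry of gridForm i ½ γ at a place where the indicators of equality of the first and
-- of the second coordinates are a and b.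
entry : ℚ → RM.GridSpectrum → ℚ → ℚ → ℚ
entry i γ a b =
  (1ℚ ℚ.* i ℚ.+ 0ℚ ℚ.* (a ℚ.- i)) ℚ.* (γ zero zero ℚ.* ½ ℚ.+ γ zero (suc zero) ℚ.* (b ℚ.- ½)) ℚ.+
  (0ℚ ℚ.* i ℚ.+ 1ℚ ℚ.* (a ℚ.- i)) ℚ.* (γ (suc zero) zero ℚ.* ½ ℚ.+ γ (suc zero) (suc zero) ℚ.* (b ℚ.- ½))

module _ where
  open +-*-Solver using (Polynomial; solve; _:+_; _:*_; :-_; _:-_; _:=_; con)

  private
    -- The same entry, as an expression for the ring solver.
    entryP : ∀ {k} → (i g₀₀ g₀₁ g₁₀ g₁₁ a b : Polynomial k) → Polynomial k
    entryP i g₀₀ g₀₁ g₁₀ g₁₁ a b =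
      (con 1ℚ :* i :+ con 0ℚ :* (a :- i)) :* (g₀₀ :* con ½ :+ g₀₁ :* (b :- con ½)) :+
      (con 0ℚ :* i :+ con 1ℚ :* (a :- i)) :* (g₁₀ :* con ½ :+ g₁₁ :* (b :- con ½))

  -- The left side is the entry of a Laplacian with degree N, that is,
  -- N ab - (a (1 - b) + b (1 - a)), up to a term that vanishes when N i = 1.
  laplacian-identity : ∀ N i a b →
    ((N ℚ.+ 2ℚ) ℚ.* (a ℚ.* b) ℚ.- a ℚ.- b) ℚ.+ b ℚ.* (1ℚ ℚ.- N ℚ.* i) ≡ entry i (laplacianSpectrum N) a b
  laplacian-identity = solve 4 (λ N i a b →
    ((N :+ con 2ℚ) :* (a :* b) :- a :- b) :+ b :* (con 1ℚ :- N :* i) :=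
    entryP i (con 0ℚ) (con 2ℚ) N (N :+ con 2ℚ) a b) refl

  -- The last term vanishes when N i = 1.
  resistance-identity : ∀ N i j a b → let e = entry i (pseudoinverseSpectrum i j) in
    e 1ℚ 1ℚ ℚ.+ e 1ℚ 1ℚ ℚ.- 2ℚ ℚ.* e a b ≡
    entry i (resistanceSpectrum N i j) a b ℚ.+ (1ℚ ℚ.- N ℚ.* i) ℚ.* (i ℚ.+ j)
  resistance-identity = solve 5 (λ N i j a b →
    let e = entryP i (con 0ℚ) (con ½) i j in
    e (con 1ℚ) (con 1ℚ) :+ e (con 1ℚ) (con 1ℚ) :- con 2ℚ :* e a b :=
    entryP i (con 2ℚ :* (con ½ :+ (N :- con 1ℚ) :* (i :+ j)))
      (:- (con 2ℚ :* con ½)) (:- (con 2ℚ :* i)) (:- (con 2ℚ :* j)) a b :+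
    (con 1ℚ :- N :* i) :* (i :+ j)) refl

-- The prism over a complete graph.

-- Here n = m + 1, so that n is positive.
module Prism (m : ℕ) where
  open +-*-Solver using (solve; _:+_; _:*_; _:-_; _:=_; con)

  n : ℕ
  n = suc m

  -- The numbers n, 1/n and 1/(n + 2).
  N i j : ℚ
  N = fromℕ n
  i = ℤ.+ 1 ℚ./ n
  j = ℤ.+ 1 ℚ./ (n ℕ.+ 2)

  Ni≡1 : N ℚ.* i ≡ 1ℚ
  Ni≡1 = trans (ℚ.*-comm N i) (/-*-cancel (ℤ.+ 1) n)

  [N+2]j≡1 : (N ℚ.+ 2ℚ) ℚ.* j ≡ 1ℚ
  [N+2]j≡1 = trans (ℚ.*-comm _ j) (trans (cong (j ℚ.*_) (sym (ι-+ (ℤ.+ n) (ℤ.+ 2)))) (/-*-cancel (ℤ.+ 1) (n ℕ.+ 2)))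

  -- The rational matrices on the vertices of the prism over K n, by their four eigenvalues.
  form : RM.GridSpectrum → RM.Matrix (n ℕ.* 2) (n ℕ.* 2)
  form = RM.gridForm {n} {2} i ½

  -- Eigenvalues of the Laplacian, of its pseudoinverse, and of the resistance matrix.
  λᴸ λ† ρ : RM.GridSpectrum
  λᴸ = laplacianSpectrum N
  λ† = pseudoinverseSpectrum i j
  ρ  = resistanceSpectrum N i j

  -- Every approximation of A is the rational matrix with eigenvalues γ.
  record Represents (A : Matrix (n ℕ.* 2) (n ℕ.* 2)) (γ : RM.GridSpectrum) : Set where
    constructor represents
    field entries : ∀ t → A at t RM.≋ form γ
  open Represents

  represents-⊗ : ∀ {A B γ γ′} → Represents A γ → Represents B γ′ →
    Represents (A ⊗ B) (λ a b → γ a b ℚ.* γ′ a b)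
  represents-⊗ {A} {B} {γ} {γ′} rA rB = represents λ t x y → trans (at-⊗ A B t x y) (trans
    (RM.⊗-cong {A = A at t} {A′ = form γ} {B = B at t} {B′ = form γ′} (entries rA t) (entries rB t) x y)
    (RM.gridForm-⊗ {n} {2} {i} {½} Ni≡1 refl γ γ′ x y))

  represents-≋ : ∀ {A B γ γ′} → Represents A γ → Represents B γ′ → (∀ a b → γ a b ≡ γ′ a b) → A ≋ B
  represents-≋ {A} {B} {γ} {γ′} rA rB γ≡γ′ x y = pointwise⇒≈ {A x y} {B x y} λ t →
    trans (entries rA t x y) (trans (RM.gridForm-cong {n} {2} {i} {½} {γ} {γ′} γ≡γ′ x y) (sym (entries rB t x y)))

  represents-sym : ∀ {A γ} → Represents A γ → A ᵀ ≋ A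
  represents-sym {A} {γ} rA x y = pointwise⇒≈ {A y x} {A x y} λ t →
    trans (entries rA t y x) (trans (RM.gridForm-sym {n} {2} i ½ γ y x) (sym (entries rA t x y)))

  -- An entry depends only on the two indicators p and q of equality of coordinates, so this
  -- is an identity of polynomials modulo N i = 1.
  laplacian-represents : Represents (laplacian (K n □ K 2)) λᴸ
  entries laplacian-represents t x y = begin
    seq (laplacian (K n □ K 2) x y) t
      ≡⟨ laplacian-at (K n □ K 2) t x y ⟩
    (if does (x Fin.≟ y) then fromℕ (degree (K n □ K 2) x) else 0ℚ) ℚ.- bit (adjacent p q)
      ≡⟨ cong₂ (λ b d → (if b then d else 0ℚ) ℚ.- bit (adjacent p q)) (≟-remQuot {n} 2 x y) (degree-prism n x) ⟩
    (if p ∧ q then N else 0ℚ) ℚ.- bit (adjacent p q)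
      ≡⟨ polynomial p q ⟩
    ((N ℚ.+ 2ℚ) ℚ.* (bit p ℚ.* bit q) ℚ.- bit p ℚ.- bit q) ℚ.+ bit q ℚ.* (1ℚ ℚ.- 1ℚ)
      ≡⟨ cong (λ e → ((N ℚ.+ 2ℚ) ℚ.* (bit p ℚ.* bit q) ℚ.- bit p ℚ.- bit q) ℚ.+ bit q ℚ.* (1ℚ ℚ.- e)) Ni≡1 ⟨
    ((N ℚ.+ 2ℚ) ℚ.* (bit p ℚ.* bit q) ℚ.- bit p ℚ.- bit q) ℚ.+ bit q ℚ.* (1ℚ ℚ.- N ℚ.* i)
      ≡⟨ laplacian-identity N i (bit p) (bit q) ⟩
    form λᴸ x y ∎
    where
    open ≡-Reasoning
    p = does (quotient {n} 2 x Fin.≟ quotient {n} 2 y)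
    q = does (remainder {n} 2 x Fin.≟ remainder {n} 2 y)
    polynomial : ∀ p q → (if p ∧ q then N else 0ℚ) ℚ.- bit (adjacent p q) ≡
      ((N ℚ.+ 2ℚ) ℚ.* (bit p ℚ.* bit q) ℚ.- bit p ℚ.- bit q) ℚ.+ bit q ℚ.* (1ℚ ℚ.- 1ℚ)
    polynomial true true = solve 1 (λ N → N :- con 0ℚ :=
      ((N :+ con 2ℚ) :* (con 1ℚ :* con 1ℚ) :- con 1ℚ :- con 1ℚ) :+ con 1ℚ :* (con 1ℚ :- con 1ℚ)) refl N
    polynomial true false = solve 1 (λ N → con 0ℚ :- con 1ℚ :=
      ((N :+ con 2ℚ) :* (con 1ℚ :* con 0ℚ) :- con 1ℚ :- con 0ℚ) :+ con 0ℚ :* (con 1ℚ :- con 1ℚ)) refl N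
    polynomial false true = solve 1 (λ N → con 0ℚ :- con 1ℚ :=
      ((N :+ con 2ℚ) :* (con 0ℚ :* con 1ℚ) :- con 0ℚ :- con 1ℚ) :+ con 1ℚ :* (con 1ℚ :- con 1ℚ)) refl N
    polynomial false false = solve 1 (λ N → con 0ℚ :- con 0ℚ :=
      ((N :+ con 2ℚ) :* (con 0ℚ :* con 0ℚ) :- con 0ℚ :- con 0ℚ) :+ con 0ℚ :* (con 1ℚ :- con 1ℚ)) refl N

  lift-represents : ∀ γ → Represents (lift (form γ)) γ
  lift-represents γ = represents λ t x y → refl

  L† : Matrix (n ℕ.* 2) (n ℕ.* 2)
  L† = lift (form λ†)

  moorePenrose : IsMoorePenroseInverse (laplacian (K n □ K 2)) L†
  moorePenrose = record
    { AXA≋A = represents-≋ (represents-⊗ (represents-⊗ rL r†) rL) rL λᴸλ†λᴸ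
    ; XAX≋X = represents-≋ (represents-⊗ (represents-⊗ r† rL) r†) r† λ†λᴸλ†
    ; AX-symmetric = represents-sym (represents-⊗ rL r†)
    ; XA-symmetric = represents-sym (represents-⊗ r† rL)
    }
    where
    rL = laplacian-represents
    r† : Represents L† λ†
    r† = lift-represents λ†
    cancel : ∀ p q → p ℚ.* q ≡ 1ℚ → p ℚ.* q ℚ.* p ≡ p
    cancel p q pq = trans (cong (ℚ._* p) pq) (ℚ.*-identityˡ p)
    λᴸλ†λᴸ : ∀ a b → λᴸ a b ℚ.* λ† a b ℚ.* λᴸ a b ≡ λᴸ a b
    λᴸλ†λᴸ zero       zero       = refl
    λᴸλ†λᴸ zero       (suc zero) = refl
    λᴸλ†λᴸ (suc zero) zero       = cancel N i Ni≡1
    λᴸλ†λᴸ (suc zero) (suc zero) = cancel (N ℚ.+ 2ℚ) j [N+2]j≡1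
    λ†λᴸλ† : ∀ a b → λ† a b ℚ.* λᴸ a b ℚ.* λ† a b ≡ λ† a b
    λ†λᴸλ† zero       zero       = refl
    λ†λᴸλ† zero       (suc zero) = refl
    λ†λᴸλ† (suc zero) zero       = cancel i N (trans (ℚ.*-comm i N) Ni≡1)
    λ†λᴸλ† (suc zero) (suc zero) = cancel j (N ℚ.+ 2ℚ) (trans (ℚ.*-comm j (N ℚ.+ 2ℚ)) [N+2]j≡1)

  resistance-represents : Represents (resistanceMatrix L†) ρ
  entries resistance-represents t x y = begin
    form λ† x x ℚ.+ form λ† y y ℚ.- 2ℚ ℚ.* form λ† x y
      ≡⟨ cong₂ (λ c d → c ℚ.+ d ℚ.- 2ℚ ℚ.* form λ† x y) (diagonal-entry x) (diagonal-entry y) ⟩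
    entry i λ† 1ℚ 1ℚ ℚ.+ entry i λ† 1ℚ 1ℚ ℚ.- 2ℚ ℚ.* entry i λ† a b
      ≡⟨ resistance-identity N i j a b ⟩
    entry i ρ a b ℚ.+ (1ℚ ℚ.- N ℚ.* i) ℚ.* (i ℚ.+ j)
      ≡⟨ cong (λ e → entry i ρ a b ℚ.+ (1ℚ ℚ.- e) ℚ.* (i ℚ.+ j)) Ni≡1 ⟩
    entry i ρ a b ℚ.+ 0ℚ ℚ.* (i ℚ.+ j)
      ≡⟨ trans (cong (entry i ρ a b ℚ.+_) (ℚ.*-zeroˡ (i ℚ.+ j))) (ℚ.+-identityʳ (entry i ρ a b)) ⟩
    form ρ x y ∎
    where
    open ≡-Reasoning
    a b : ℚ
    a = δ (quotient {n} 2 x) (quotient {n} 2 y)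
    b = δ (remainder {n} 2 x) (remainder {n} 2 y)
    diagonal-entry : ∀ z → form λ† z z ≡ entry i λ† 1ℚ 1ℚ
    diagonal-entry z = cong₂ (entry i λ†) (RM.δ-diagonal (quotient {n} 2 z)) (RM.δ-diagonal (remainder {n} 2 z))

  module DetR = Determinant ℝ-commutativeRing

  -- The flag and the triangular form of the resistance matrix, over the reals.
  gridFlag : Matrix (n ℕ.* 2) (n ℕ.* 2)
  gridFlag = lift (RM.gridFlag {m} {1})

  gridTriangle : Matrix (n ℕ.* 2) (n ℕ.* 2)
  gridTriangle = lift (RM.gridTriangle {m} {1} i ½ ρ)

  resistance-eigenvalues : AreEigenvalues (resistanceMatrix L†) (λ x → gridTriangle x x)
  resistance-eigenvalues = DetR.triangularised⇒eigenvalues (resistanceMatrix L†) gridFlag gridTriangle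
    ( (λ x → pointwise⇒≈ {gridFlag x x} {1#} λ _ → proj₁ flag-unitLower x)
    , (λ {x} {y} x<y → pointwise⇒≈ {gridFlag x y} {0#} λ _ → proj₂ flag-unitLower x<y) )
    (λ {x} {y} y<x → pointwise⇒≈ {gridTriangle x y} {0#} λ _ → RM.gridTriangle-upper {m} {1} i ½ ρ {x} {y} y<x)
    (λ x y → pointwise⇒≈ {(R ⊗ gridFlag) x y} {(gridFlag ⊗ gridTriangle) x y} λ t → begin
      seq ((R ⊗ gridFlag) x y) t
        ≡⟨ at-⊗ R gridFlag t x y ⟩
      ((R at t) RM.⊗ RM.gridFlag {m} {1}) x y
        ≡⟨ RM.⊗-cong {A = R at t} {A′ = form ρ} {B = RM.gridFlag {m} {1}} {B′ = RM.gridFlag {m} {1}}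
             (entries resistance-represents t) (λ _ _ → refl) x y ⟩
      (form ρ RM.⊗ RM.gridFlag {m} {1}) x y
        ≡⟨ RM.gridForm-flag {m} {1} {i} {½} Ni≡1 refl ρ x y ⟩
      (RM.gridFlag {m} {1} RM.⊗ RM.gridTriangle {m} {1} i ½ ρ) x y
        ≡⟨ at-⊗ gridFlag gridTriangle t x y ⟨
      seq ((gridFlag ⊗ gridTriangle) x y) t ∎)
    where
    open ≡-Reasoning
    R : Matrix (n ℕ.* 2) (n ℕ.* 2)
    R = resistanceMatrix L†
    flag-unitLower : RM.UnitLower (RM.gridFlag {m} {1})
    flag-unitLower = RM.gridFlag-unitLower {m} {1}

  -- The number n - 1.
  M : ℚ
  M = fromℕ m

  -- The eigenvalue on the constants is nonnegative, all others are negative.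
  sum-abs-ρ : RM.sum (λ v → RM.sum λ u → ℚ.∣ ρ (RM.class {m} v) (RM.class {1} u) ∣) ≡
    2ℚ ℚ.+ (2ℚ ℚ.+ 2ℚ) ℚ.* ((N ℚ.- 1ℚ) ℚ.* (i ℚ.+ j))
  sum-abs-ρ = begin
    (ℚ.∣ ρ zero zero ∣ ℚ.+ (ℚ.∣ ρ zero (suc zero) ∣ ℚ.+ 0ℚ)) ℚ.+ RM.sum {m} (λ _ → s)
      ≡⟨ cong₂ ℚ._+_ (cong₂ (λ a b → a ℚ.+ (b ℚ.+ 0ℚ)) (ℚ.0≤p⇒∣p∣≡p ρ₀₀≥0) (refl {x = 2ℚ ℚ.* ½})) (RM.sum-const m s) ⟩
    (ρ zero zero ℚ.+ (2ℚ ℚ.* ½ ℚ.+ 0ℚ)) ℚ.+ M ℚ.* s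
      ≡⟨ cong₂ (λ M s → (ρ zero zero ℚ.+ (2ℚ ℚ.* ½ ℚ.+ 0ℚ)) ℚ.+ M ℚ.* s) (sym N-1≡M)
           (cong₂ (λ a b → a ℚ.+ (b ℚ.+ 0ℚ)) (abs-neg-double i i≥0) (abs-neg-double j j≥0)) ⟩
    (ρ zero zero ℚ.+ (2ℚ ℚ.* ½ ℚ.+ 0ℚ)) ℚ.+ (N ℚ.- 1ℚ) ℚ.* (2ℚ ℚ.* i ℚ.+ (2ℚ ℚ.* j ℚ.+ 0ℚ))
      ≡⟨ solve 3 (λ N i j →
           ((con 2ℚ :* (con ½ :+ (N :- con 1ℚ) :* (i :+ j))) :+ (con 2ℚ :* con ½ :+ con 0ℚ)) :+
           (N :- con 1ℚ) :* (con 2ℚ :* i :+ (con 2ℚ :* j :+ con 0ℚ)) :=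
           con 2ℚ :+ (con 2ℚ :+ con 2ℚ) :* ((N :- con 1ℚ) :* (i :+ j))) refl N i j ⟩
    2ℚ ℚ.+ (2ℚ ℚ.+ 2ℚ) ℚ.* ((N ℚ.- 1ℚ) ℚ.* (i ℚ.+ j)) ∎
    where
    open ≡-Reasoning
    s = ℚ.∣ ρ (suc zero) zero ∣ ℚ.+ (ℚ.∣ ρ (suc zero) (suc zero) ∣ ℚ.+ 0ℚ)
    N-1≡M : N ℚ.- 1ℚ ≡ M
    N-1≡M = trans (cong (ℚ._- 1ℚ) (fromℕ-suc m)) (solve 1 (λ M → con 1ℚ :+ M :- con 1ℚ := M) refl M)
    i≥0 : 0ℚ ℚ.≤ i
    i≥0 = ℚ.nonNegative⁻¹ i {{ℚ.normalize-nonNeg 1 n}}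
    j≥0 : 0ℚ ℚ.≤ j
    j≥0 = ℚ.nonNegative⁻¹ j {{ℚ.normalize-nonNeg 1 (n ℕ.+ 2)}}
    M≥0 : 0ℚ ℚ.≤ M
    M≥0 = ℚ.nonNegative⁻¹ M {{ℚ.normalize-nonNeg m 1}}
    +-nonNeg : ∀ {p q} → 0ℚ ℚ.≤ p → 0ℚ ℚ.≤ q → 0ℚ ℚ.≤ p ℚ.+ q
    +-nonNeg = ℚ.+-mono-≤
    *-nonNeg : ∀ {p q} → 0ℚ ℚ.≤ p → 0ℚ ℚ.≤ q → 0ℚ ℚ.≤ p ℚ.* q
    *-nonNeg {p} {q} p≥0 q≥0 = subst (ℚ._≤ p ℚ.* q) (ℚ.*-zeroʳ p) (ℚ.*-monoˡ-≤-nonNeg p {{ℚ.nonNegative p≥0}} q≥0)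
    2ℚ≥0 : 0ℚ ℚ.≤ 2ℚ
    2ℚ≥0 = ℚ.nonNegative⁻¹ 2ℚ
    ρ₀₀≥0 : 0ℚ ℚ.≤ ρ zero zero
    ρ₀₀≥0 = *-nonNeg 2ℚ≥0 (+-nonNeg (ℚ.nonNegative⁻¹ ½)
      (*-nonNeg (subst (0ℚ ℚ.≤_) (sym N-1≡M) M≥0) (+-nonNeg i≥0 j≥0)))
    abs-neg-double : ∀ p → 0ℚ ℚ.≤ p → ℚ.∣ ℚ.- (2ℚ ℚ.* p) ∣ ≡ 2ℚ ℚ.* p
    abs-neg-double p p≥0 = trans (ℚ.∣-p∣≡∣p∣ (2ℚ ℚ.* p)) (ℚ.0≤p⇒∣p∣≡p (*-nonNeg 2ℚ≥0 p≥0))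

  -- The claimed energy.
  E_R : ℚ
  E_R = (ℤ.+ (10 ℕ.* n ℕ.^ 2 ℕ.+ 4 ℕ.* n) ℤ.- ℤ.+ 8) ℚ./ (n ℕ.* (n ℕ.+ 2))

  -- Denominators are cleared by multiplying with N (N + 2) i j = 1.
  E_R-value : 2ℚ ℚ.+ (2ℚ ℚ.+ 2ℚ) ℚ.* ((N ℚ.- 1ℚ) ℚ.* (i ℚ.+ j)) ≡ E_R
  E_R-value = begin
    total
      ≡⟨ ℚ.*-identityʳ total ⟨
    total ℚ.* 1ℚ
      ≡⟨ cong (total ℚ.*_) unit ⟨
    total ℚ.* (N ℚ.* (N ℚ.+ 2ℚ) ℚ.* (i ℚ.* j))
      ≡⟨ solve 3 (λ N i j →
           (con 2ℚ :+ (con 2ℚ :+ con 2ℚ) :* ((N :- con 1ℚ) :* (i :+ j))) :* (N :* (N :+ con 2ℚ) :* (i :* j)) :=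
           (con 2ℚ :* N :* (N :+ con 2ℚ) :+ (con 2ℚ :+ con 2ℚ) :* ((N :- con 1ℚ) :*
             (N :* i :* (N :+ con 2ℚ) :+ N :* ((N :+ con 2ℚ) :* j)))) :* (i :* j)) refl N i j ⟩
    numerator (N ℚ.* i) ((N ℚ.+ 2ℚ) ℚ.* j) ℚ.* (i ℚ.* j)
      ≡⟨ cong₂ (λ a b → numerator a b ℚ.* (i ℚ.* j)) Ni≡1 [N+2]j≡1 ⟩
    numerator 1ℚ 1ℚ ℚ.* (i ℚ.* j)
      ≡⟨ cong (ℚ._* (i ℚ.* j)) (begin
           numerator 1ℚ 1ℚ
             ≡⟨ solve 1 (λ N →
                  con 2ℚ :* N :* (N :+ con 2ℚ) :+ (con 2ℚ :+ con 2ℚ) :* ((N :- con 1ℚ) :*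
                    (con 1ℚ :* (N :+ con 2ℚ) :+ N :* con 1ℚ)) :=
                  con (fromℕ 10) :* (N :* (N :* con 1ℚ)) :+ con (fromℕ 4) :* N :+ con (ℚ.- fromℕ 8)) refl N ⟩
           fromℕ 10 ℚ.* (N ℚ.* (N ℚ.* 1ℚ)) ℚ.+ fromℕ 4 ℚ.* N ℚ.+ (ℚ.- fromℕ 8)
             ≡⟨ expand ⟨
           ι p
             ≡⟨ /-*-cancel p d ⟨
           E_R ℚ.* fromℕ d ∎) ⟩
    E_R ℚ.* fromℕ d ℚ.* (i ℚ.* j)
      ≡⟨ ℚ.*-assoc E_R (fromℕ d) (i ℚ.* j) ⟩
    E_R ℚ.* (fromℕ d ℚ.* (i ℚ.* j))
      ≡⟨ cong (λ e → E_R ℚ.* (e ℚ.* (i ℚ.* j))) (trans (fromℕ-* n (n ℕ.+ 2)) (cong (N ℚ.*_) (fromℕ-+ n 2))) ⟩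
    E_R ℚ.* (N ℚ.* (N ℚ.+ 2ℚ) ℚ.* (i ℚ.* j))
      ≡⟨ cong (E_R ℚ.*_) unit ⟩
    E_R ℚ.* 1ℚ
      ≡⟨ ℚ.*-identityʳ E_R ⟩
    E_R ∎
    where
    open ≡-Reasoning
    total : ℚ
    total = 2ℚ ℚ.+ (2ℚ ℚ.+ 2ℚ) ℚ.* ((N ℚ.- 1ℚ) ℚ.* (i ℚ.+ j))
    p : ℤ.ℤ
    p = ℤ.+ (10 ℕ.* n ℕ.^ 2 ℕ.+ 4 ℕ.* n) ℤ.- ℤ.+ 8
    d : ℕ
    d = n ℕ.* (n ℕ.+ 2)
    numerator : ℚ → ℚ → ℚ
    numerator a b = 2ℚ ℚ.* N ℚ.* (N ℚ.+ 2ℚ) ℚ.+ (2ℚ ℚ.+ 2ℚ) ℚ.* ((N ℚ.- 1ℚ) ℚ.* (a ℚ.* (N ℚ.+ 2ℚ) ℚ.+ N ℚ.* b))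
    unit : N ℚ.* (N ℚ.+ 2ℚ) ℚ.* (i ℚ.* j) ≡ 1ℚ
    unit = trans (solve 3 (λ N i j → N :* (N :+ con 2ℚ) :* (i :* j) := (N :* i) :* ((N :+ con 2ℚ) :* j)) refl N i j)
                 (cong₂ ℚ._*_ Ni≡1 [N+2]j≡1)
    fromℕ-+ : ∀ a b → fromℕ (a ℕ.+ b) ≡ fromℕ a ℚ.+ fromℕ b
    fromℕ-+ a b = ι-+ (ℤ.+ a) (ℤ.+ b)
    fromℕ-* : ∀ a b → fromℕ (a ℕ.* b) ≡ fromℕ a ℚ.* fromℕ b
    fromℕ-* a b = trans (cong ι (ℤ.pos-* a b)) (ι-* (ℤ.+ a) (ℤ.+ b))
    expand : ι p ≡ fromℕ 10 ℚ.* (N ℚ.* (N ℚ.* 1ℚ)) ℚ.+ fromℕ 4 ℚ.* N ℚ.+ (ℚ.- fromℕ 8)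
    expand = trans (ι-+ (ℤ.+ (10 ℕ.* n ℕ.^ 2 ℕ.+ 4 ℕ.* n)) (ℤ.- ℤ.+ 8)) (cong (ℚ._+ (ℚ.- fromℕ 8))
      (trans (fromℕ-+ (10 ℕ.* n ℕ.^ 2) (4 ℕ.* n)) (cong₂ ℚ._+_
        (trans (fromℕ-* 10 (n ℕ.^ 2)) (cong (fromℕ 10 ℚ.*_)
          (trans (fromℕ-* n (n ℕ.^ 1)) (cong (N ℚ.*_) (fromℕ-* n 1)))))
        (fromℕ-* 4 n))))

  sum-abs-eigenvalues : sum (λ x → ∣ gridTriangle x x ∣ᴿ) ≈ᴿ fromℚ E_R
  sum-abs-eigenvalues = pointwise⇒≈ {sum (λ x → ∣ gridTriangle x x ∣ᴿ)} {fromℚ E_R} λ t → begin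
    seq (sum (λ x → ∣ gridTriangle x x ∣ᴿ)) t
      ≡⟨ seq-sum (λ x → ∣ gridTriangle x x ∣ᴿ) t ⟩
    RM.sum (λ x → ℚ.∣ RM.gridTriangle {m} {1} i ½ ρ x x ∣)
      ≡⟨ RM.sum-cong-≋ {n ℕ.* 2} (λ x → cong ℚ.∣_∣ (RM.gridTriangle-diagonal {m} {1} i ½ ρ x)) ⟩
    RM.sum (λ x → ℚ.∣ ρ (RM.class {m} (quotient {n} 2 x)) (RM.class {1} (remainder {n} 2 x)) ∣)
      ≡⟨ RM.sum-remQuot {n} {2} (λ (v , u) → ℚ.∣ ρ (RM.class {m} v) (RM.class {1} u) ∣) ⟩
    RM.sum (λ v → RM.sum λ u → ℚ.∣ ρ (RM.class {m} v) (RM.class {1} u) ∣)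
      ≡⟨ sum-abs-ρ ⟩
    2ℚ ℚ.+ (2ℚ ℚ.+ 2ℚ) ℚ.* ((N ℚ.- 1ℚ) ℚ.* (i ℚ.+ j))
      ≡⟨ E_R-value ⟩
    E_R ∎
    where open ≡-Reasoning

  resistanceEnergy : ResistanceEnergy (K n □ K 2) (fromℚ E_R)
  resistanceEnergy = record
    { connected           = □-connected (K n) (K 2) (K-connected n) (K-connected 2)
    ; L†                  = L†
    ; L†-isMoorePenrose   = moorePenrose
    ; eigenvalues         = λ x → gridTriangle x x
    ; eigenvalues-correct = resistance-eigenvalues
    ; energy              = sum-abs-eigenvalues
    }

open import Data.Nat.Base using (ℕ; NonZero; _+_; _*_; _^_)
open import Data.Integer.Base using (+_; _-_)
open import Data.Rational.Base using (_/_)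

corollary5p5 :
  (n : ℕ) .{{_ : NonZero n}} →
  ResistanceEnergy (K n □ K 2)
    (fromℚ ((+ (10 * n ^ 2 + 4 * n) - + 8) / (n * (n + 2))))
corollary5p5 (suc m) = Prism.resistanceEnergy m
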